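{- For any triangle-free graph $G$ with at least one edge, $$\beta(G)\leq\frac18\rho(G)-\frac{C_4(G)}{12\rho(G)}.$$
   Context: All graphs are finite and simple. Let $G$ be a graph with $n\geq 1$ vertices. The edge density is $\rho(G)=\frac{2|E(G)|}{n^2}$. The density of quadrilaterals $C_4(G)$ is defined as follows: sample $v_1,v_2,v_3,v_4\in V(G)$ uniformly and completely independently (with repetitions allowed), and form the graph on the vertex set $\{1,2,3,4\}$ in which $\{i,j\}$ is an edge if and only if $\{v_i,v_j\}\in E(G)$ (in particular $\{i,j\}$ is not an edge if $v_i=v_j$); then $C_4(G)$ is the probability that this graph is isomorphic to the 4-cycle $C_4$. A half in $G$ is a function $\mu: V(G)\to[0,1]$ such that $\sum_{v\in V(G)}\mu(v)=n/2$. Put $\beta(G,\mu)=\frac1{n^2}\sum_{\{u,v\}\in E(G)}\mu(u)\mu(v)$ (each edge is counted once) and $\beta(G)=\min\{\beta(G,\mu): \mu \text{ is a half in } G\}$. -}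

module Defs where

open import Level using (0ℓ)
open import Data.Nat.Base as ℕ using (ℕ; suc; NonZero; _%_)
import Data.Nat.Properties as ℕ
open import Data.Integer.Base using (+_)
open import Data.Rational.Base as ℚ using (ℚ; 0ℚ; 1ℚ; Positive; _/_; 1/_; ∣_∣)
import Data.Rational.Properties as ℚ
open import Data.Rational.Solver using (module +-*-Solver)
open import Data.Fin.Base as Fin using (Fin; toℕ; finToFun; funToFin)
open import Data.Fin.Properties using (_≟_; _<?_; any?; all?; finToFun-funToFin; <-cmp)
open import Data.List.Base using (List; _∷_; length; map; foldr; filter; allFin; cartesianProduct)
open import Data.List.Membership.Propositional using (_∈_)
open import Data.List.Membership.Propositional.Properties
  using (∈-filter⁺; ∈-cartesianProduct⁺; ∈-allFin)
open import Data.Product.Base using (Σ; ∃₂; ∃-syntax; _×_; _,_; proj₁; proj₂)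
open import Data.Sum.Base using (_⊎_; swap)
open import Function.Bundles using (_⇔_; mk⇔; Equivalence)
open import Function.Definitions using (Injective; Surjective; Bijective)
open import Relation.Binary.Core using (Rel)
open import Relation.Binary.Definitions
  using (Symmetric; Irreflexive; Decidable; tri<; tri≈; tri>)
open import Relation.Binary.PropositionalEquality
open import Relation.Nullary using (¬_; Dec; contradiction)
open import Relation.Nullary.Decidable
  using (map′; _×-dec_; _⊎-dec_; _→-dec_; ¬?; toWitness)

------------------------------------------------------------------------
-- Real numbers, as Cauchy sequences of rationals. Equality is the
-- relation _≈ᴿ_ (not _≡_).

Cauchy : (ℕ → ℚ) → Set
Cauchy x = ∀ ε → 0ℚ ℚ.< ε →
  ∃[ N ] ∀ m n → N ℕ.≤ m → N ℕ.≤ n → ∣ x m ℚ.- x n ∣ ℚ.≤ ε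

record ℝ : Set where
  constructor mkℝ
  field
    seq    : ℕ → ℚ
    cauchy : Cauchy seq

open ℝ public

infix  4 _≤ᴿ_ _≈ᴿ_
infixl 6 _+ᴿ_
infixl 7 _*ᴿ_

_≤ᴿ_ : Rel ℝ 0ℓ
x ≤ᴿ y = ∀ ε → 0ℚ ℚ.< ε → ∃[ N ] ∀ n → N ℕ.≤ n → seq x n ℚ.≤ seq y n ℚ.+ ε

_≈ᴿ_ : Rel ℝ 0ℓ
x ≈ᴿ y = ∀ ε → 0ℚ ℚ.< ε → ∃[ N ] ∀ n → N ℕ.≤ n → ∣ seq x n ℚ.- seq y n ∣ ℚ.≤ ε

fromℚ : ℚ → ℝ
fromℚ q = mkℝ (λ _ → q) λ ε 0<ε → 0 , λ _ _ _ _ →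
  subst (ℚ._≤ ε) (sym (cong ∣_∣ (ℚ.+-inverseʳ q))) (ℚ.<⇒≤ 0<ε)

private
  -- Splits ε into B * δ + B * δ.
  split : ∀ B → 0ℚ ℚ.< B → ∀ ε → 0ℚ ℚ.< ε →
          ∃[ δ ] 0ℚ ℚ.< δ × B ℚ.* δ ℚ.+ B ℚ.* δ ≡ ε
  split B 0<B ε 0<ε = δ , ℚ.positive⁻¹ δ , eq
    where
    instance
      B+  = ℚ.positive 0<B
      ε+  = ℚ.positive 0<ε
      2B+ = ℚ.pos+pos⇒pos B B
      nz  = ℚ.pos⇒nonZero (B ℚ.+ B)
      i+  = ℚ.1/pos⇒pos (B ℚ.+ B)
    r = 1/ (B ℚ.+ B)
    δ = r ℚ.* ε
    instance
      δ+ = ℚ.pos*pos⇒pos r ε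
    eq : B ℚ.* δ ℚ.+ B ℚ.* δ ≡ ε
    eq = begin
      B ℚ.* δ ℚ.+ B ℚ.* δ        ≡⟨ ℚ.*-distribʳ-+ δ B B ⟨
      (B ℚ.+ B) ℚ.* (r ℚ.* ε)    ≡⟨ ℚ.*-assoc (B ℚ.+ B) r ε ⟨
      (B ℚ.+ B) ℚ.* r ℚ.* ε      ≡⟨ cong (ℚ._* ε) (ℚ.*-inverseʳ (B ℚ.+ B)) ⟩
      1ℚ ℚ.* ε                   ≡⟨ ℚ.*-identityˡ ε ⟩
      ε                          ∎
      where open ≡-Reasoning

  +-cauchy : ∀ {x y} → Cauchy x → Cauchy y → Cauchy (λ n → x n ℚ.+ y n)
  +-cauchy {x} {y} cx cy ε 0<ε
    with δ , 0<δ , eq ← split 1ℚ (ℚ.positive⁻¹ 1ℚ) ε 0<ε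
    with M , hx ← cx δ 0<δ | N , hy ← cy δ 0<δ
    = M ℕ.⊔ N , λ m n p q → begin
      ∣ (x m ℚ.+ y m) ℚ.- (x n ℚ.+ y n) ∣
        ≡⟨ cong ∣_∣ (solve 4 (λ a b c d →
             (a :+ b) :- (c :+ d) := (a :- c) :+ (b :- d)) refl (x m) (y m) (x n) (y n)) ⟩
      ∣ (x m ℚ.- x n) ℚ.+ (y m ℚ.- y n) ∣
        ≤⟨ ℚ.∣p+q∣≤∣p∣+∣q∣ (x m ℚ.- x n) (y m ℚ.- y n) ⟩
      ∣ x m ℚ.- x n ∣ ℚ.+ ∣ y m ℚ.- y n ∣
        ≤⟨ ℚ.+-mono-≤ (hx m n (ℕ.m⊔n≤o⇒m≤o M N p) (ℕ.m⊔n≤o⇒m≤o M N q))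
                      (hy m n (ℕ.m⊔n≤o⇒n≤o M N p) (ℕ.m⊔n≤o⇒n≤o M N q)) ⟩
      δ ℚ.+ δ                    ≡⟨ cong₂ ℚ._+_ (ℚ.*-identityˡ δ) (ℚ.*-identityˡ δ) ⟨
      1ℚ ℚ.* δ ℚ.+ 1ℚ ℚ.* δ      ≡⟨ eq ⟩
      ε                          ∎
    where
    open ℚ.≤-Reasoning
    open +-*-Solver

  bounded : ∀ {x} → Cauchy x →
            ∃₂ λ N B → 0ℚ ℚ.≤ B × (∀ n → N ℕ.≤ n → ∣ x n ∣ ℚ.≤ B)
  bounded {x} cx
    with N , h ← cx 1ℚ (ℚ.positive⁻¹ 1ℚ)
    = N , 1ℚ ℚ.+ ∣ x N ∣
    , ℚ.+-mono-≤ (ℚ.<⇒≤ (ℚ.positive⁻¹ 1ℚ)) (ℚ.0≤∣p∣ (x N))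
    , λ n p → begin
      ∣ x n ∣                        ≡⟨ cong ∣_∣ (solve 2 (λ a b → a := (a :- b) :+ b) refl (x n) (x N)) ⟩
      ∣ (x n ℚ.- x N) ℚ.+ x N ∣      ≤⟨ ℚ.∣p+q∣≤∣p∣+∣q∣ (x n ℚ.- x N) (x N) ⟩
      ∣ x n ℚ.- x N ∣ ℚ.+ ∣ x N ∣    ≤⟨ ℚ.+-monoˡ-≤ ∣ x N ∣ (h n N p ℕ.≤-refl) ⟩
      1ℚ ℚ.+ ∣ x N ∣                 ∎
    where
    open ℚ.≤-Reasoning
    open +-*-Solver

  ∣*∣-mono : ∀ {p q a b} → ∣ p ∣ ℚ.≤ a → ∣ q ∣ ℚ.≤ b → ∣ p ℚ.* q ∣ ℚ.≤ a ℚ.* b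
  ∣*∣-mono {p} {q} {a} {b} p≤a q≤b = begin
    ∣ p ℚ.* q ∣        ≡⟨ ℚ.∣p*q∣≡∣p∣*∣q∣ p q ⟩
    ∣ p ∣ ℚ.* ∣ q ∣    ≤⟨ ℚ.*-monoʳ-≤-nonNeg ∣ q ∣ {{ℚ.nonNegative (ℚ.0≤∣p∣ q)}} p≤a ⟩
    a ℚ.* ∣ q ∣        ≤⟨ ℚ.*-monoˡ-≤-nonNeg a {{ℚ.nonNegative (ℚ.≤-trans (ℚ.0≤∣p∣ p) p≤a)}} q≤b ⟩
    a ℚ.* b            ∎
    where open ℚ.≤-Reasoning

  *-diff : ∀ a b c d → a ℚ.* b ℚ.- c ℚ.* d ≡ a ℚ.* (b ℚ.- d) ℚ.+ d ℚ.* (a ℚ.- c)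
  *-diff = solve 4 (λ a b c d → a :* b :- c :* d := a :* (b :- d) :+ d :* (a :- c)) refl
    where open +-*-Solver

  *-close : ∀ {A B δ ε a b c d} → 0ℚ ℚ.≤ A ℚ.+ B → 0ℚ ℚ.< δ →
            (A ℚ.+ B ℚ.+ 1ℚ) ℚ.* δ ℚ.+ (A ℚ.+ B ℚ.+ 1ℚ) ℚ.* δ ≡ ε →
            ∣ a ∣ ℚ.≤ A → ∣ d ∣ ℚ.≤ B → ∣ a ℚ.- c ∣ ℚ.≤ δ → ∣ b ℚ.- d ∣ ℚ.≤ δ →
            ∣ a ℚ.* b ℚ.- c ℚ.* d ∣ ℚ.≤ ε
  *-close {A} {B} {δ} {ε} {a} {b} {c} {d} 0≤A+B 0<δ eq a≤A d≤B a-c b-d = begin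
    ∣ a ℚ.* b ℚ.- c ℚ.* d ∣                      ≡⟨ cong ∣_∣ (*-diff a b c d) ⟩
    ∣ a ℚ.* (b ℚ.- d) ℚ.+ d ℚ.* (a ℚ.- c) ∣      ≤⟨ ℚ.∣p+q∣≤∣p∣+∣q∣ (a ℚ.* (b ℚ.- d)) (d ℚ.* (a ℚ.- c)) ⟩
    ∣ a ℚ.* (b ℚ.- d) ∣ ℚ.+ ∣ d ℚ.* (a ℚ.- c) ∣  ≤⟨ ℚ.+-mono-≤ (∣*∣-mono {a} {b ℚ.- d} a≤A b-d) (∣*∣-mono {d} {a ℚ.- c} d≤B a-c) ⟩
    A ℚ.* δ ℚ.+ B ℚ.* δ                          ≡⟨ ℚ.*-distribʳ-+ δ A B ⟨
    (A ℚ.+ B) ℚ.* δ                              ≤⟨ ℚ.*-monoʳ-≤-nonNeg δ A+B≤C ⟩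
    C ℚ.* δ                                      ≡⟨ ℚ.+-identityʳ (C ℚ.* δ) ⟨
    C ℚ.* δ ℚ.+ 0ℚ                               ≤⟨ ℚ.+-monoʳ-≤ (C ℚ.* δ) 0≤Cδ ⟩
    C ℚ.* δ ℚ.+ C ℚ.* δ                          ≡⟨ eq ⟩
    ε                                            ∎
    where
    open ℚ.≤-Reasoning
    C = A ℚ.+ B ℚ.+ 1ℚ
    instance
      δ≥0 = ℚ.nonNegative (ℚ.<⇒≤ 0<δ)
    A+B≤C : A ℚ.+ B ℚ.≤ C
    A+B≤C = subst (ℚ._≤ C) (ℚ.+-identityʳ (A ℚ.+ B))
      (ℚ.+-monoʳ-≤ (A ℚ.+ B) (ℚ.<⇒≤ (ℚ.positive⁻¹ 1ℚ)))
    0≤Cδ : 0ℚ ℚ.≤ C ℚ.* δ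
    0≤Cδ = subst (ℚ._≤ C ℚ.* δ) (ℚ.*-zeroˡ δ)
      (ℚ.*-monoʳ-≤-nonNeg δ (ℚ.≤-trans 0≤A+B A+B≤C))

  *-cauchy : ∀ {x y} → Cauchy x → Cauchy y → Cauchy (λ n → x n ℚ.* y n)
  *-cauchy {x} {y} cx cy ε 0<ε =
    let K , A , 0≤A , hA = bounded cx
        L , B , 0≤B , hB = bounded cy
        0≤A+B = ℚ.+-mono-≤ 0≤A 0≤B
        δ , 0<δ , eq = split (A ℚ.+ B ℚ.+ 1ℚ) (ℚ.+-mono-≤-< 0≤A+B (ℚ.positive⁻¹ 1ℚ)) ε 0<ε
        M , hx = cx δ 0<δ
        N , hy = cy δ 0<δ
    in (K ℕ.⊔ L) ℕ.⊔ (M ℕ.⊔ N) , λ m n p q →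
      let pKL = ℕ.m⊔n≤o⇒m≤o (K ℕ.⊔ L) (M ℕ.⊔ N) p
          qKL = ℕ.m⊔n≤o⇒m≤o (K ℕ.⊔ L) (M ℕ.⊔ N) q
          pMN = ℕ.m⊔n≤o⇒n≤o (K ℕ.⊔ L) (M ℕ.⊔ N) p
          qMN = ℕ.m⊔n≤o⇒n≤o (K ℕ.⊔ L) (M ℕ.⊔ N) q
      in *-close {A} {B} {δ} {ε} {x m} {y m} {x n} {y n} 0≤A+B 0<δ eq
           (hA m (ℕ.m⊔n≤o⇒m≤o K L pKL))
           (hB n (ℕ.m⊔n≤o⇒n≤o K L qKL))
           (hx m n (ℕ.m⊔n≤o⇒m≤o M N pMN) (ℕ.m⊔n≤o⇒m≤o M N qMN))
           (hy m n (ℕ.m⊔n≤o⇒n≤o M N pMN) (ℕ.m⊔n≤o⇒n≤o M N qMN))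

_+ᴿ_ : ℝ → ℝ → ℝ
x +ᴿ y = mkℝ (λ n → seq x n ℚ.+ seq y n) (+-cauchy {seq x} {seq y} (cauchy x) (cauchy y))

_*ᴿ_ : ℝ → ℝ → ℝ
x *ᴿ y = mkℝ (λ n → seq x n ℚ.* seq y n) (*-cauchy {seq x} {seq y} (cauchy x) (cauchy y))

sumᴿ : List ℝ → ℝ
sumᴿ = foldr _+ᴿ_ (fromℚ 0ℚ)

------------------------------------------------------------------------
-- Graphs

record Graph (n : ℕ) : Set₁ where
  field
    Adj        : Rel (Fin n) 0ℓ
    Adj-sym    : Symmetric Adj
    Adj-irrefl : Irreflexive _≡_ Adj
    adj?       : Decidable Adj

open Graph public using (Adj; adj?)

TriangleFree : ∀ {n} → Graph n → Set
TriangleFree G = ∀ u v w → ¬ (Adj G u v × Adj G v w × Adj G u w)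

HasEdge : ∀ {n} → Graph n → Set
HasEdge G = ∃₂ λ u v → Adj G u v

-- Each edge {u , v} is listed once, as the pair with u < v.
edges : ∀ {n} → Graph n → List (Fin n × Fin n)
edges {n} G = filter (λ (u , v) → (u <? v) ×-dec adj? G u v)
                     (cartesianProduct (allFin n) (allFin n))

infix 4 _≅_ _≅?_

_≅_ : ∀ {m n} → Graph m → Graph n → Set
_≅_ {m} {n} G H = Σ (Fin m → Fin n) λ f →
  Bijective _≡_ _≡_ f × (∀ u v → Adj G u v ⇔ Adj H (f u) (f v))

_≅?_ : ∀ {m n} (G : Graph m) (H : Graph n) → Dec (G ≅ H)
_≅?_ {m} {n} G H =
  map′ (λ (k , i) → finToFun k , i)
       (λ (f , i) → funToFin f , respects (λ u → sym (finToFun-funToFin f u)) i)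
       (any? (λ k → isIso? (finToFun k)))
  where
  IsIso : (Fin m → Fin n) → Set
  IsIso f = Bijective _≡_ _≡_ f × (∀ u v → Adj G u v ⇔ Adj H (f u) (f v))

  injective? : ∀ f → Dec (Injective _≡_ _≡_ f)
  injective? f = map′ (λ h {u} {v} → h u v) (λ h u v → h)
    (all? λ u → all? λ v → (f u ≟ f v) →-dec (u ≟ v))

  surjective? : ∀ f → Dec (Surjective _≡_ _≡_ f)
  surjective? f =
    map′ (λ h y → proj₁ (h y) , λ { refl → proj₂ (h y) })
         (λ h y → proj₁ (h y) , proj₂ (h y) refl)
         (all? λ y → any? λ u → f u ≟ y)

  isIso? : ∀ f → Dec (IsIso f)
  isIso? f = (injective? f ×-dec surjective? f) ×-dec
    all? λ u → all? λ v →
      map′ (λ (to , from) → mk⇔ to from)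
           (λ e → Equivalence.to e , Equivalence.from e)
           ((adj? G u v →-dec adj? H (f u) (f v)) ×-dec
            (adj? H (f u) (f v) →-dec adj? G u v))

  respects : ∀ {f g} → f ≗ g → IsIso f → IsIso g
  respects {f} {g} f≗g ((inj , surj) , pres) =
    ( (λ {u} {v} eq → inj (trans (f≗g u) (trans eq (sym (f≗g v)))))
    , (λ y → proj₁ (surj y) , λ { refl → trans (sym (f≗g _)) (proj₂ (surj y) refl) }))
    , λ u v → subst₂ (λ a b → Adj G u v ⇔ Adj H a b) (f≗g u) (f≗g v) (pres u v)

-- Indices are adjacent iff their images in G are; the map need not be injective.
sampleGraph : ∀ {m n} → Graph n → (Fin m → Fin n) → Graph m
sampleGraph G v = record
  { Adj        = λ i j → Adj G (v i) (v j)
  ; Adj-sym    = Graph.Adj-sym G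
  ; Adj-irrefl = λ eq → Graph.Adj-irrefl G (cong v eq)
  ; adj?       = λ i j → adj? G (v i) (v j)
  }

cycle₄ : Graph 4
cycle₄ = record
  { Adj        = C
  ; Adj-sym    = swap
  ; Adj-irrefl = λ { {u} refl → toWitness {a? = all? λ u → ¬? (C? u u)} _ u }
  ; adj?       = C?
  }
  where
  C : Rel (Fin 4) 0ℓ
  C i j = toℕ j ≡ suc (toℕ i) % 4 ⊎ toℕ i ≡ suc (toℕ j) % 4
  C? : Decidable C
  C? i j = (toℕ j ℕ.≟ suc (toℕ i) % 4) ⊎-dec (toℕ i ℕ.≟ suc (toℕ j) % 4)

------------------------------------------------------------------------
-- Densities

ρ : ∀ {n} .{{_ : NonZero n}} → Graph n → ℚ
ρ {n} G = _/_ (+ (2 ℕ.* length (edges G))) (n ℕ.^ 2) {{ℕ.m^n≢0 n 2}}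

-- Samples (v₁, v₂, v₃, v₄) are enumerated through Fin (n ^ 4) ≅ (Fin 4 → Fin n).
C₄ : ∀ {n} .{{_ : NonZero n}} → Graph n → ℚ
C₄ {n} G = _/_ (+ length (filter (λ k → sampleGraph G (finToFun {n} {4} k) ≅? cycle₄)
                                 (allFin (n ℕ.^ 4))))
               (n ℕ.^ 4) {{ℕ.m^n≢0 n 4}}

12ρ : ∀ {n} .{{_ : NonZero n}} → Graph n → ℚ
12ρ G = (+ 12 / 1) ℚ.* ρ G

12ρ-nonZero : ∀ {n} .{{_ : NonZero n}} (G : Graph n) → HasEdge G → ℚ.NonZero (12ρ G)
12ρ-nonZero {n} G (u , v , uv) = ℚ.pos⇒nonZero (12ρ G) {{12ρ-pos}}
  where
  listed : ∀ {u v} → u Fin.< v → Adj G u v → (u , v) ∈ edges G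
  listed u<v uv = ∈-filter⁺ (λ (u , v) → (u <? v) ×-dec adj? G u v)
    (∈-cartesianProduct⁺ (∈-allFin _) (∈-allFin _)) (u<v , uv)

  edge : ∃[ e ] e ∈ edges G
  edge with <-cmp u v
  ... | tri< u<v _ _ = (u , v) , listed u<v uv
  ... | tri≈ _ u≡v _ = contradiction uv (Graph.Adj-irrefl G u≡v)
  ... | tri> _ _ v<u = (v , u) , listed v<u (Graph.Adj-sym G uv)

  ρ-pos : ∀ {es : List (Fin n × Fin n)} {e} → e ∈ es → ∀ d .{{_ : NonZero d}} →
          Positive ((+ (2 ℕ.* length es)) / d)
  ρ-pos {_ ∷ es} _ d = ℚ.normalize-pos (2 ℕ.* suc (length es)) d

  12ρ-pos : Positive (12ρ G)
  12ρ-pos = ℚ.pos*pos⇒pos (+ 12 / 1) (ρ G)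
    {{ρ-pos (proj₂ edge) (n ℕ.^ 2) {{ℕ.m^n≢0 n 2}}}}

------------------------------------------------------------------------
-- Halves

IsHalf : ∀ {n} → (Fin n → ℝ) → Set
IsHalf {n} μ =
  (∀ v → fromℚ 0ℚ ≤ᴿ μ v × μ v ≤ᴿ fromℚ 1ℚ) ×
  sumᴿ (map μ (allFin n)) ≈ᴿ fromℚ (+ n / 2)

β : ∀ {n} .{{_ : NonZero n}} → Graph n → (Fin n → ℝ) → ℝ
β {n} G μ = fromℚ (_/_ (+ 1) (n ℕ.^ 2) {{ℕ.m^n≢0 n 2}}) *ᴿ
            sumᴿ (map (λ (u , v) → μ u *ᴿ μ v) (edges G))

-- b = β(G), the minimum (attained) of β(G, μ) over all halves μ.
IsMinβ : ∀ {n} .{{_ : NonZero n}} → Graph n → ℝ → Set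
IsMinβ {n} G b =
  (Σ (Fin n → ℝ) λ μ → IsHalf μ × b ≈ᴿ β G μ) ×
  (∀ (μ : Fin n → ℝ) → IsHalf μ → b ≤ᴿ β G μ)

-- With B u v = Σ A i j u i v j one has n² β(G, μ) = B μ μ / 2.
--
-- The minimum. Since B is concave along e_p - e_q, a rational half can be pushed, without
-- increasing B, until at most one of its values is outside {0, 1}; hence the minimum over
-- rational halves is a minimum over finitely many candidates. The approximations of a real
-- half are within small error of rational halves, so the same value bounds real halves.
--
-- The bound. For an edge vw with |N(v)| ≥ |N(w)| let a and b be the indicators of the disjoint
-- independent sets N(v) and N(w), and r = 1 - a - b. If |N(v)| < n/2, choose p so that a + p r
-- and b + (1 - p) r are halves; one of the two has at most (|E| - e(N(v), N(w))) / 4 edges.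
-- If |N(v)| ≥ n/2, a multiple of a is a half without edges. Averaging the resulting bound over
-- all ordered edges vw turns e(N(v), N(w)) into hom(C₄) / 2|E|, and n⁴ C₄(G) ≤ 3 hom(C₄).

module Submission where

open import Defs
open import Data.Bool.Base using (if_then_else_)
open import Data.Nat.Base as ℕ using (ℕ; zero; suc; NonZero)
import Data.Nat.Properties as ℕ
open import Data.Integer.Base as ℤ using (+_)
import Data.Integer.Properties as ℤ
open import Data.Rational.Base as ℚ hiding (NonZero)
import Data.Rational.Properties as ℚ
open import Data.Rational.Solver using (module +-*-Solver)
import Data.Rational.Unnormalised.Base as ℚᵘ
import Data.Rational.Unnormalised.Properties as ℚᵘ
open import Data.Fin.Base as Fin using (Fin; zero; suc; toℕ; fromℕ<; finToFun; funToFin;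
  combine; quotient; remainder; _↑ˡ_; _↑ʳ_)
open import Data.Fin.Patterns using (0F; 1F; 2F; 3F)
import Data.Fin.Properties as Fin
open import Data.List.Base
  using (List; []; _∷_; _++_; length; map; foldr; filter; tabulate; allFin; cartesianProduct)
import Data.List.Relation.Unary.All as All
open import Data.List.Relation.Unary.All.Properties using (all-filter)
open import Data.List.Membership.Propositional using (_∈_)
open import Data.List.Membership.Propositional.Properties
  using (∈-map⁺; ∈-filter⁺; ∈-cartesianProduct⁺; ∈-allFin)
open import Relation.Binary.Bundles using (DecTotalOrder)
open import Data.List.Extrema (DecTotalOrder.totalOrder ℚ.≤-decTotalOrder)
  using (argmin; argmin-all; f[argmin]≤f[xs])
open import Data.Product.Base using (∃-syntax; _×_; _,_; proj₁; proj₂)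
open import Data.Sum.Base using (_⊎_; inj₁; inj₂)
open import Function.Base using (_∘_)
open import Relation.Binary.PropositionalEquality
open import Relation.Nullary using (¬_; Dec; yes; no; contradiction)
open import Relation.Nullary.Decidable using (does; ¬?; _×-dec_; _⊎-dec_; _→-dec_; toWitness)
open import Relation.Binary.Definitions using (tri<; tri≈; tri>)
open import Function.Bundles using (Equivalence)
open import Algebra.Bundles using (CommutativeRing)
open import Algebra.Properties.Semiring.Sum (CommutativeRing.semiring ℚ.+-*-commutativeRing)
  using (sum; sum-cong-≗; ∑-distrib-+; ∑-comm; *-distribˡ-sum; *-distribʳ-sum)

open +-*-Solver

-- Order and arithmetic of the rationals

0≤1 : 0ℚ ≤ 1ℚ
0≤1 = ℚ.nonNegative⁻¹ 1ℚ

0≤+ : ∀ {p q} → 0ℚ ≤ p → 0ℚ ≤ q → 0ℚ ≤ p + q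
0≤+ = ℚ.+-mono-≤

0≤* : ∀ {p q} → 0ℚ ≤ p → 0ℚ ≤ q → 0ℚ ≤ p * q
0≤* {p} {q} 0≤p 0≤q = ℚ.nonNegative⁻¹ (p * q)
  {{ℚ.nonNeg*nonNeg⇒nonNeg p {{nonNegative 0≤p}} q {{nonNegative 0≤q}}}}

p≤q⇒0≤q-p : ∀ {p q} → p ≤ q → 0ℚ ≤ q - p
p≤q⇒0≤q-p {p} {q} p≤q = subst (_≤ q - p) (ℚ.+-inverseʳ p) (ℚ.+-monoˡ-≤ (- p) p≤q)

0≤q-p⇒p≤q : ∀ {p q} → 0ℚ ≤ q - p → p ≤ q
0≤q-p⇒p≤q {p} {q} 0≤q-p = subst₂ _≤_ (ℚ.+-identityˡ p)
  (solve 2 (λ p q → q :- p :+ p := q) refl p q) (ℚ.+-monoˡ-≤ p 0≤q-p)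

-- The form in which most polynomial inequalities below are proved: the ring solver rewrites `q - p`
-- as an expression `d` that is visibly nonnegative.
≤-by-difference : ∀ {p q d} → q - p ≡ d → 0ℚ ≤ d → p ≤ q
≤-by-difference eq 0≤d = 0≤q-p⇒p≤q (subst (0ℚ ≤_) (sym eq) 0≤d)

-- Natural numbers inside the rationals

infix 9 ι_

ι_ : ℕ → ℚ
ι n = + n / 1

-- Normalised fractions do not compute on variables. Since `fromℚᵘ` respects sums and products,
-- identities for `ι` and `_/_` reduce to integer identities between unnormalised fractions.
fromℚᵘ-homo-+ : ∀ p q → fromℚᵘ p + fromℚᵘ q ≡ fromℚᵘ (p ℚᵘ.+ q)
fromℚᵘ-homo-+ p q = ℚ.toℚᵘ-injective (begin
  toℚᵘ (fromℚᵘ p + fromℚᵘ q)               ≈⟨ ℚ.toℚᵘ-homo-+ (fromℚᵘ p) (fromℚᵘ q) ⟩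
  toℚᵘ (fromℚᵘ p) ℚᵘ.+ toℚᵘ (fromℚᵘ q)     ≈⟨ ℚᵘ.+-cong (ℚ.toℚᵘ-fromℚᵘ p) (ℚ.toℚᵘ-fromℚᵘ q) ⟩
  p ℚᵘ.+ q                                 ≈⟨ ℚ.toℚᵘ-fromℚᵘ (p ℚᵘ.+ q) ⟨
  toℚᵘ (fromℚᵘ (p ℚᵘ.+ q))                 ∎)
  where open ℚᵘ.≃-Reasoning

fromℚᵘ-homo-* : ∀ p q → fromℚᵘ p * fromℚᵘ q ≡ fromℚᵘ (p ℚᵘ.* q)
fromℚᵘ-homo-* p q = ℚ.toℚᵘ-injective (begin
  toℚᵘ (fromℚᵘ p * fromℚᵘ q)               ≈⟨ ℚ.toℚᵘ-homo-* (fromℚᵘ p) (fromℚᵘ q) ⟩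
  toℚᵘ (fromℚᵘ p) ℚᵘ.* toℚᵘ (fromℚᵘ q)     ≈⟨ ℚᵘ.*-cong (ℚ.toℚᵘ-fromℚᵘ p) (ℚ.toℚᵘ-fromℚᵘ q) ⟩
  p ℚᵘ.* q                                 ≈⟨ ℚ.toℚᵘ-fromℚᵘ (p ℚᵘ.* q) ⟨
  toℚᵘ (fromℚᵘ (p ℚᵘ.* q))                 ∎)
  where open ℚᵘ.≃-Reasoning

ι-+ : ∀ m n → ι (m ℕ.+ n) ≡ ι m + ι n
ι-+ m n = sym (trans (fromℚᵘ-homo-+ p q) (ℚ.fromℚᵘ-cong {p ℚᵘ.+ q} {r} (ℚᵘ.*≡* (cong (ℤ._* + 1)
  (cong₂ ℤ._+_ (ℤ.*-identityʳ (+ m)) (ℤ.*-identityʳ (+ n)))))))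
  where
  p = ℚᵘ.mkℚᵘ (+ m) 0
  q = ℚᵘ.mkℚᵘ (+ n) 0
  r = ℚᵘ.mkℚᵘ (+ (m ℕ.+ n)) 0

ι-* : ∀ m n → ι (m ℕ.* n) ≡ ι m * ι n
ι-* m n = sym (trans (fromℚᵘ-homo-* p q) (ℚ.fromℚᵘ-cong {p ℚᵘ.* q} {r} (ℚᵘ.*≡* (cong (ℤ._* + 1)
  (sym (ℤ.pos-* m n))))))
  where
  p = ℚᵘ.mkℚᵘ (+ m) 0
  q = ℚᵘ.mkℚᵘ (+ n) 0
  r = ℚᵘ.mkℚᵘ (+ (m ℕ.* n)) 0

/-*-cancel : ∀ m d .{{_ : NonZero d}} → (+ m / d) * ι d ≡ ι m
/-*-cancel m (suc d) = trans (fromℚᵘ-homo-* p q) (ℚ.fromℚᵘ-cong {p ℚᵘ.* q} {r} (ℚᵘ.*≡*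
  (trans (ℤ.*-assoc (+ m) (+ suc d) (+ 1)) (cong (+ m ℤ.*_)
    (trans (ℤ.*-identityʳ (+ suc d)) (cong +_ (sym (ℕ.*-identityʳ (suc d)))))))))
  where
  p = ℚᵘ.mkℚᵘ (+ m) d
  q = ℚᵘ.mkℚᵘ (+ suc d) 0
  r = ℚᵘ.mkℚᵘ (+ m) 0

0≤ι : ∀ n → 0ℚ ≤ ι n
0≤ι n = ℚ.nonNegative⁻¹ (ι n) {{ℚ.normalize-nonNeg n 1}}

-- Indicators of decidable propositions

𝟙 : ∀ {P : Set} → Dec P → ℚ
𝟙 P? = if does P? then 1ℚ else 0ℚ

0≤𝟙 : ∀ {P} (P? : Dec P) → 0ℚ ≤ 𝟙 P?
0≤𝟙 (yes _) = 0≤1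
0≤𝟙 (no _)  = ℚ.≤-refl

𝟙≤1 : ∀ {P} (P? : Dec P) → 𝟙 P? ≤ 1ℚ
𝟙≤1 (yes _) = ℚ.≤-refl
𝟙≤1 (no _)  = 0≤1

𝟙-yes : ∀ {P} (P? : Dec P) → P → 𝟙 P? ≡ 1ℚ
𝟙-yes (yes _) _ = refl
𝟙-yes (no ¬p) p = contradiction p ¬p

𝟙-no : ∀ {P} (P? : Dec P) → ¬ P → 𝟙 P? ≡ 0ℚ
𝟙-no (yes p) ¬p = contradiction p ¬p
𝟙-no (no _)  _  = refl

-- Finite sums

infix 8 _⟨_⟩+_⟨_⟩

-- Halves, their perturbations and the splitting of the vertex set are written in this one shape, so
-- that `sum-linear` and `B-quadratic` evaluate them.
_⟨_⟩+_⟨_⟩ : ∀ {n} → ℚ → (Fin n → ℚ) → ℚ → (Fin n → ℚ) → Fin n → ℚ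
(s ⟨ f ⟩+ t ⟨ g ⟩) i = s * f i + t * g i

sum-linear : ∀ {n} s (f : Fin n → ℚ) t g → sum (s ⟨ f ⟩+ t ⟨ g ⟩) ≡ s * sum f + t * sum g
sum-linear s f t g = trans (∑-distrib-+ (λ i → s * f i) (λ i → t * g i))
  (sym (cong₂ _+_ (*-distribˡ-sum s f) (*-distribˡ-sum t g)))

sum-mono : ∀ {n} {f g : Fin n → ℚ} → (∀ i → f i ≤ g i) → sum f ≤ sum g
sum-mono {zero}  f≤g = ℚ.≤-refl
sum-mono {suc n} f≤g = ℚ.+-mono-≤ (f≤g zero) (sum-mono (f≤g ∘ suc))

sum-nonneg : ∀ {n} {f : Fin n → ℚ} → (∀ i → 0ℚ ≤ f i) → 0ℚ ≤ sum f
sum-nonneg {zero}  0≤f = ℚ.≤-refl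
sum-nonneg {suc n} 0≤f = 0≤+ (0≤f zero) (sum-nonneg (0≤f ∘ suc))

sum-const : ∀ n c → sum {n} (λ _ → c) ≡ ι n * c
sum-const zero    c = sym (ℚ.*-zeroˡ c)
sum-const (suc n) c = trans (cong (_+_ c) (sum-const n c))
  (trans (solve 2 (λ c x → c :+ x :* c := (con 1ℚ :+ x) :* c) refl c (ι n)) (cong (_* c) (sym (ι-+ 1 n))))

δ : ∀ {n} → Fin n → Fin n → ℚ
δ p i = 𝟙 (i Fin.≟ p)

sum-zero : ∀ n → sum {n} (λ _ → 0ℚ) ≡ 0ℚ
sum-zero n = trans (sum-const n 0ℚ) (ℚ.*-zeroʳ (ι n))

sum-δ : ∀ {n} p (f : Fin n → ℚ) → sum (λ i → δ p i * f i) ≡ f p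
sum-δ {suc n} zero    f = trans (cong₂ _+_ (ℚ.*-identityˡ (f zero))
  (trans (sum-cong-≗ (λ i → ℚ.*-zeroˡ (f (suc i)))) (sum-zero n))) (ℚ.+-identityʳ (f zero))
sum-δ {suc n} (suc p) f = trans (cong₂ _+_ (ℚ.*-zeroˡ (f zero)) (sum-δ p (f ∘ suc))) (ℚ.+-identityˡ (f (suc p)))

sum-δ₁ : ∀ {n} (p : Fin n) → sum (δ p) ≡ 1ℚ
sum-δ₁ p = trans (sum-cong-≗ (λ i → sym (ℚ.*-identityʳ (δ p i)))) (sum-δ p (λ _ → 1ℚ))

-- The adjacency form

module BilinearForm {n} (G : Graph n) where

  A : Fin n → Fin n → ℚ
  A i j = 𝟙 (adj? G i j)

  A-sym : ∀ i j → A i j ≡ A j i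
  A-sym i j with adj? G i j
  ... | yes ij = sym (𝟙-yes (adj? G j i) (Graph.Adj-sym G ij))
  ... | no ¬ij = sym (𝟙-no (adj? G j i) (¬ij ∘ Graph.Adj-sym G))

  A-irrefl : ∀ i → A i i ≡ 0ℚ
  A-irrefl i = 𝟙-no (adj? G i i) (Graph.Adj-irrefl G refl)

  0≤A : ∀ i j → 0ℚ ≤ A i j
  0≤A i j = 0≤𝟙 (adj? G i j)

  B : (u v : Fin n → ℚ) → ℚ
  B u v = sum λ i → sum λ j → A i j * (u i * v j)

  B-cong : ∀ {u u′ v v′} → u ≗ u′ → v ≗ v′ → B u v ≡ B u′ v′
  B-cong u≗u′ v≗v′ = sum-cong-≗ λ i → sum-cong-≗ λ j → cong (A i j *_) (cong₂ _*_ (u≗u′ i) (v≗v′ j))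

  B-sym : ∀ u v → B u v ≡ B v u
  B-sym u v = trans (∑-comm (λ i j → A i j * (u i * v j)))
    (sum-cong-≗ λ j → sum-cong-≗ λ i → cong₂ _*_ (A-sym i j) (ℚ.*-comm (u i) (v j)))

  0≤B : ∀ {u v} → (∀ i → 0ℚ ≤ u i) → (∀ i → 0ℚ ≤ v i) → 0ℚ ≤ B u v
  0≤B 0≤u 0≤v = sum-nonneg λ i → sum-nonneg λ j → 0≤* (0≤A i j) (0≤* (0≤u i) (0≤v j))

  B-linearˡ : ∀ s u t w v → B (s ⟨ u ⟩+ t ⟨ w ⟩) v ≡ s * B u v + t * B w v
  B-linearˡ s u t w v = trans
    (sum-cong-≗ λ i → trans
      (sum-cong-≗ λ j → solve 6 (λ a s u t w v →
        a :* ((s :* u :+ t :* w) :* v) := s :* (a :* (u :* v)) :+ t :* (a :* (w :* v)))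
        refl (A i j) s (u i) t (w i) (v j))
      (sum-linear s (λ j → A i j * (u i * v j)) t (λ j → A i j * (w i * v j))))
    (sum-linear s (λ i → sum λ j → A i j * (u i * v j)) t (λ i → sum λ j → A i j * (w i * v j)))

  B-linearʳ : ∀ s u t w v → B v (s ⟨ u ⟩+ t ⟨ w ⟩) ≡ s * B v u + t * B v w
  B-linearʳ s u t w v = trans (B-sym v _) (trans (B-linearˡ s u t w v)
    (cong₂ _+_ (cong (s *_) (B-sym u v)) (cong (t *_) (B-sym w v))))

  B-quadratic : ∀ s u t w → B (s ⟨ u ⟩+ t ⟨ w ⟩) (s ⟨ u ⟩+ t ⟨ w ⟩) ≡
    s * s * B u u + (s * t * B u w + s * t * B u w) + t * t * B w w
  B-quadratic s u t w = begin
    B x x                                        ≡⟨ B-linearˡ s u t w x ⟩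
    s * B u x + t * B w x
      ≡⟨ cong₂ (λ y z → s * y + t * z) (B-linearʳ s u t w u) (B-linearʳ s u t w w) ⟩
    s * (s * B u u + t * B u w) + t * (s * B w u + t * B w w)
      ≡⟨ cong (λ y → s * (s * B u u + t * B u w) + t * (s * y + t * B w w)) (B-sym w u) ⟩
    s * (s * B u u + t * B u w) + t * (s * B u w + t * B w w)
      ≡⟨ solve 5 (λ s t a b c → s :* (s :* a :+ t :* b) :+ t :* (s :* b :+ t :* c) :=
           s :* s :* a :+ (s :* t :* b :+ s :* t :* b) :+ t :* t :* c)
           refl s t (B u u) (B u w) (B w w) ⟩
    s * s * B u u + (s * t * B u w + s * t * B u w) + t * t * B w w ∎
    where
    open ≡-Reasoning
    x = s ⟨ u ⟩+ t ⟨ w ⟩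

  B-δ-δ : ∀ p q → B (δ p) (δ q) ≡ A p q
  B-δ-δ p q = trans
    (sum-cong-≗ λ i → trans
      (sum-cong-≗ λ j → solve 3 (λ a x y → a :* (x :* y) := y :* (a :* x)) refl (A i j) (δ p i) (δ q j))
      (trans (sum-δ q (λ j → A i j * δ p i)) (ℚ.*-comm (A i q) (δ p i))))
    (sum-δ p (λ i → A i q))

-- Rational halves

IsHalfℚ : ∀ {n} → (Fin n → ℚ) → Set
IsHalfℚ {n} μ = (∀ i → 0ℚ ≤ μ i × μ i ≤ 1ℚ) × sum μ ≡ + n / 2

isHalfℚ? : ∀ {n} (μ : Fin n → ℚ) → Dec (IsHalfℚ μ)
isHalfℚ? {n} μ = Fin.all? (λ i → (0ℚ ℚ.≤? μ i) ×-dec (μ i ℚ.≤? 1ℚ)) ×-dec (sum μ ℚ.≟ + n / 2)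

IsHalfℚ-resp-≗ : ∀ {n} {μ ν : Fin n → ℚ} → μ ≗ ν → IsHalfℚ μ → IsHalfℚ ν
IsHalfℚ-resp-≗ μ≗ν (bounds , total) =
  (λ i → subst (λ x → 0ℚ ≤ x × x ≤ 1ℚ) (μ≗ν i) (bounds i)) ,
  trans (sym (sum-cong-≗ μ≗ν)) total

n/2+n/2≡n : ∀ n → + n / 2 + + n / 2 ≡ ι n
n/2+n/2≡n n = trans (solve 1 (λ h → h :+ h := h :* con (ι 2)) refl (+ n / 2)) (/-*-cancel n 2)

-- Serves as the default value of the `argmin` over the candidates, so that the result is a half
-- whatever the list contains.
½-isHalfℚ : ∀ n → IsHalfℚ {n} (λ _ → ½)
½-isHalfℚ n = (λ _ → ℚ.nonNegative⁻¹ ½ , 0≤q-p⇒p≤q {½} {1ℚ} (ℚ.nonNegative⁻¹ ½)) , (begin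
  sum {n} (λ _ → ½)      ≡⟨ sum-const n ½ ⟩
  ι n * ½                ≡⟨ cong (_* ½) (n/2+n/2≡n n) ⟨
  (+ n / 2 + + n / 2) * ½ ≡⟨ solve 1 (λ h → (h :+ h) :* con ½ := h) refl (+ n / 2) ⟩
  + n / 2                ∎)
  where open ≡-Reasoning

argmin-≤ : ∀ {A : Set} (f : A → ℚ) ⊤ xs {x} → x ∈ xs → f (argmin f ⊤ xs) ≤ f x
argmin-≤ f ⊤ xs = All.lookup (f[argmin]≤f[xs] {f = f} ⊤ xs)

Is01 : ℚ → Set
Is01 x = x ≡ 0ℚ ⊎ x ≡ 1ℚ

-- The minimum over rational halves

module Minimum {n} (G : Graph n) where

  open BilinearForm G

  -- The form is concave along δ p - δ q, so one of the two ends of the segment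
  -- of halves in that direction does not increase it.
  module _ {μ : Fin n → ℚ} (half : IsHalfℚ μ) {p q : Fin n} (p≢q : p ≢ q) where

    shift : ℚ → Fin n → ℚ
    shift t = 1ℚ ⟨ μ ⟩+ t ⟨ 1ℚ ⟨ δ p ⟩+ - 1ℚ ⟨ δ q ⟩ ⟩

    shift-p : ∀ t → shift t p ≡ μ p + t
    shift-p t = trans
      (cong₂ (λ x y → 1ℚ * μ p + t * (1ℚ * x + - 1ℚ * y))
        (𝟙-yes (p Fin.≟ p) refl) (𝟙-no (p Fin.≟ q) p≢q))
      (solve 2 (λ m t → con 1ℚ :* m :+ t :* (con 1ℚ :* con 1ℚ :+ con (- 1ℚ) :* con 0ℚ) := m :+ t) refl (μ p) t)

    shift-q : ∀ t → shift t q ≡ μ q - t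
    shift-q t = trans
      (cong₂ (λ x y → 1ℚ * μ q + t * (1ℚ * x + - 1ℚ * y))
        (𝟙-no (q Fin.≟ p) (p≢q ∘ sym)) (𝟙-yes (q Fin.≟ q) refl))
      (solve 2 (λ m t → con 1ℚ :* m :+ t :* (con 1ℚ :* con 0ℚ :+ con (- 1ℚ) :* con 1ℚ) := m :- t) refl (μ q) t)

    shift-other : ∀ t i → i ≢ p → i ≢ q → shift t i ≡ μ i
    shift-other t i i≢p i≢q = trans
      (cong₂ (λ x y → 1ℚ * μ i + t * (1ℚ * x + - 1ℚ * y))
        (𝟙-no (i Fin.≟ p) i≢p) (𝟙-no (i Fin.≟ q) i≢q))
      (solve 2 (λ m t → con 1ℚ :* m :+ t :* (con 1ℚ :* con 0ℚ :+ con (- 1ℚ) :* con 0ℚ) := m) refl (μ i) t)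

    sum-shift : ∀ t → sum (shift t) ≡ sum μ
    sum-shift t = trans (sum-linear 1ℚ μ t _)
      (trans (cong (λ x → 1ℚ * sum μ + t * x) (sum-linear 1ℚ (δ p) (- 1ℚ) (δ q)))
      (trans (cong₂ (λ x y → 1ℚ * sum μ + t * (1ℚ * x + - 1ℚ * y)) (sum-δ₁ p) (sum-δ₁ q))
      (solve 2 (λ m t → con 1ℚ :* m :+ t :* (con 1ℚ :* con 1ℚ :+ con (- 1ℚ) :* con 1ℚ) := m) refl (sum μ) t)))

    shift-isHalfℚ : ∀ t → 0ℚ ≤ t → t ≤ 1ℚ - μ p → t ≤ μ q → IsHalfℚ (shift t)
    shift-isHalfℚ t 0≤t t≤1-μp t≤μq = bounds , trans (sum-shift t) (proj₂ half)
      where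
      bounds-cases : ∀ i → Dec (i ≡ p) → Dec (i ≡ q) → 0ℚ ≤ shift t i × shift t i ≤ 1ℚ
      bounds-cases i (yes refl) _ = subst (λ x → 0ℚ ≤ x × x ≤ 1ℚ) (sym (shift-p t))
        ( 0≤+ (proj₁ (proj₁ half p)) 0≤t
        , ≤-by-difference (solve 2 (λ m t → con 1ℚ :- (m :+ t) := con 1ℚ :- m :- t) refl (μ p) t) (p≤q⇒0≤q-p t≤1-μp))
      bounds-cases i (no _) (yes refl) = subst (λ x → 0ℚ ≤ x × x ≤ 1ℚ) (sym (shift-q t))
        ( p≤q⇒0≤q-p t≤μq
        , ≤-by-difference (solve 2 (λ m t → con 1ℚ :- (m :- t) := con 1ℚ :- m :+ t) refl (μ q) t)
            (0≤+ (p≤q⇒0≤q-p (proj₂ (proj₁ half q))) 0≤t))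
      bounds-cases i (no i≢p) (no i≢q) = subst (λ x → 0ℚ ≤ x × x ≤ 1ℚ) (sym (shift-other t i i≢p i≢q)) (proj₁ half i)
      bounds : ∀ i → 0ℚ ≤ shift t i × shift t i ≤ 1ℚ
      bounds i = bounds-cases i (i Fin.≟ p) (i Fin.≟ q)

    -- As a function of `t` the form has linear coefficient `2 (Lp - Lq)` and quadratic coefficient
    -- `B x x = - 2 A p q`, the diagonal of `A` being zero. Neither is positive.
    B-shift-≤ : ∀ t → 0ℚ ≤ t → B μ (δ p) ≤ B μ (δ q) → B (shift t) (shift t) ≤ B μ μ
    B-shift-≤ t 0≤t Lp≤Lq = ≤-by-difference {d = t * (Lq - Lp) + t * (Lq - Lp) + t * t * (A p q + A p q)} eq
      (0≤+ (0≤+ 0≤tL 0≤tL) (0≤* (0≤* 0≤t 0≤t) (0≤+ (0≤A p q) (0≤A p q))))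
      where
      Lp = B μ (δ p)
      Lq = B μ (δ q)
      x = 1ℚ ⟨ δ p ⟩+ - 1ℚ ⟨ δ q ⟩
      0≤tL = 0≤* 0≤t (p≤q⇒0≤q-p Lp≤Lq)
      Bxx : B x x ≡ - (A p q + A p q)
      Bxx = trans (B-quadratic 1ℚ (δ p) (- 1ℚ) (δ q))
        (trans (cong₂ (λ a c → 1ℚ * 1ℚ * a + (1ℚ * - 1ℚ * B (δ p) (δ q) + 1ℚ * - 1ℚ * B (δ p) (δ q)) + - 1ℚ * - 1ℚ * c)
          (trans (B-δ-δ p p) (A-irrefl p)) (trans (B-δ-δ q q) (A-irrefl q)))
        (trans (solve 1 (λ b → con 1ℚ :* con 1ℚ :* con 0ℚ :+ (con 1ℚ :* con (- 1ℚ) :* b :+ con 1ℚ :* con (- 1ℚ) :* b)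
            :+ con (- 1ℚ) :* con (- 1ℚ) :* con 0ℚ := :- (b :+ b)) refl (B (δ p) (δ q)))
          (cong (λ b → - (b + b)) (B-δ-δ p q))))
      eq : B μ μ - B (shift t) (shift t) ≡ t * (Lq - Lp) + t * (Lq - Lp) + t * t * (A p q + A p q)
      eq = trans (cong (_-_ (B μ μ)) (trans (B-quadratic 1ℚ μ t x)
          (cong₂ (λ y z → 1ℚ * 1ℚ * B μ μ + (1ℚ * t * y + 1ℚ * t * y) + t * t * z)
            (B-linearʳ 1ℚ (δ p) (- 1ℚ) (δ q) μ) Bxx)))
        (solve 5 (λ m t p q a →
          m :- (con 1ℚ :* con 1ℚ :* m :+ (con 1ℚ :* t :* (con 1ℚ :* p :+ con (- 1ℚ) :* q) :+
            con 1ℚ :* t :* (con 1ℚ :* p :+ con (- 1ℚ) :* q)) :+ t :* t :* (:- (a :+ a))) :=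
          t :* (q :- p) :+ t :* (q :- p) :+ t :* t :* (a :+ a)) refl (B μ μ) t Lp Lq (A p q))

    MoveResult : Set
    MoveResult = ∃[ ν ] IsHalfℚ ν × B ν ν ≤ B μ μ × (∀ i → i ≢ p → i ≢ q → ν i ≡ μ i) × (Is01 (ν p) ⊎ Is01 (ν q))

    move-ordered : B μ (δ p) ≤ B μ (δ q) → MoveResult
    move-ordered L with ℚ.≤-total (1ℚ - μ p) (μ q)
    -- The shift goes as far as a half allows, to the smaller of `1ℚ - μ p` and `μ q`. Either `p`
    -- then reaches 1 or `q` reaches 0.
    ... | inj₁ le = shift t , shift-isHalfℚ t 0≤t ℚ.≤-refl le , B-shift-≤ t 0≤t L , shift-other t ,
      inj₁ (inj₂ (trans (shift-p t) (solve 1 (λ m → m :+ (con 1ℚ :- m) := con 1ℚ) refl (μ p))))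
      where
      t = 1ℚ - μ p
      0≤t = p≤q⇒0≤q-p (proj₂ (proj₁ half p))
    ... | inj₂ ge = shift t , shift-isHalfℚ t 0≤t ge ℚ.≤-refl , B-shift-≤ t 0≤t L , shift-other t ,
      inj₂ (inj₁ (trans (shift-q t) (ℚ.+-inverseʳ (μ q))))
      where
      t = μ q
      0≤t = proj₁ (proj₁ half q)

  move : ∀ {μ} (half : IsHalfℚ μ) {p q} (p≢q : p ≢ q) → MoveResult half p≢q
  move {μ} half {p} {q} p≢q with ℚ.≤-total (B μ (δ p)) (B μ (δ q))
  ... | inj₁ le = move-ordered half p≢q le
  ... | inj₂ ge with move-ordered half (p≢q ∘ sym) ge
  ... | ν , halfν , Bν≤ , same , inj₁ z = ν , halfν , Bν≤ , (λ i i≢p i≢q → same i i≢q i≢p) , inj₂ z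
  ... | ν , halfν , Bν≤ , same , inj₂ z = ν , halfν , Bν≤ , (λ i i≢p i≢q → same i i≢q i≢p) , inj₁ z

  Rounded : ℕ → Fin n → (Fin n → ℚ) → Set
  Rounded k p μ = ∀ i → toℕ i ℕ.< k → i ≢ p → Is01 (μ i)

  -- Induction on `k`, carrying along one index `p` whose value may be fractional. If the new index
  -- `q` differs from `p`, a move along the two settles one of them, and the other becomes the
  -- exceptional index.
  roundTo : ∀ k → k ℕ.≤ n → Fin n → ∀ {μ} → IsHalfℚ μ →
    ∃[ ν ] ∃[ p ] IsHalfℚ ν × B ν ν ≤ B μ μ × Rounded k p ν
  roundTo zero    _   p₀ {μ} half = μ , p₀ , half , ℚ.≤-refl , λ _ ()
  roundTo (suc k) k<n p₀ {μ} half
    with ν , p , halfν , Bν≤ , rounded ← roundTo k (ℕ.<⇒≤ k<n) p₀ half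
    with fromℕ< k<n Fin.≟ p
  ... | yes refl = ν , p , halfν , Bν≤ , λ i i<1+k i≢p →
    rounded i (ℕ.≤∧≢⇒< (ℕ.≤-pred i<1+k) (λ i≡k → i≢p (Fin.toℕ-injective (trans i≡k (sym (Fin.toℕ-fromℕ< k<n)))))) i≢p
  ... | no q≢p = continue (move halfν (q≢p ∘ sym))
    where
    q = fromℕ< k<n
    below : ∀ {i} → toℕ i ℕ.< suc k → i ≢ q → toℕ i ℕ.< k
    below i<1+k i≢q =
      ℕ.≤∧≢⇒< (ℕ.≤-pred i<1+k) (λ i≡k → i≢q (Fin.toℕ-injective (trans i≡k (sym (Fin.toℕ-fromℕ< k<n)))))
    continue : MoveResult halfν (q≢p ∘ sym) →
      ∃[ ξ ] ∃[ r ] IsHalfℚ ξ × B ξ ξ ≤ B μ μ × Rounded (suc k) r ξ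
    continue (ξ , halfξ , Bξ≤ , same , inj₁ z) = ξ , q , halfξ , ℚ.≤-trans Bξ≤ Bν≤ , res
      where
      res : Rounded (suc k) q ξ
      res i i<1+k i≢q with i Fin.≟ p
      ... | yes refl = z
      ... | no i≢p = subst Is01 (sym (same i i≢p i≢q)) (rounded i (below i<1+k i≢q) i≢p)
    continue (ξ , halfξ , Bξ≤ , same , inj₂ z) = ξ , p , halfξ , ℚ.≤-trans Bξ≤ Bν≤ , res
      where
      res : Rounded (suc k) p ξ
      res i i<1+k i≢p with i Fin.≟ q
      ... | yes refl = z
      ... | no i≢q = subst Is01 (sym (same i i≢p i≢q)) (rounded i (below i<1+k i≢q) i≢p)

  bit : Fin 2 → ℚ
  bit zero       = 0ℚ
  bit (suc zero) = 1ℚ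

  -- The value at `p` is the one that makes the total `n / 2`, so a 0-1 vector and an index
  -- determine the function. It may leave the unit interval, in which case it is filtered out later.
  candidate : (Fin n → ℚ) → Fin n → Fin n → ℚ
  candidate b p i with i Fin.≟ p
  ... | yes _ = + n / 2 - (sum b - b p)
  ... | no _  = b i

  candidate-≗ : ∀ {μ b p} → IsHalfℚ μ → (∀ i → i ≢ p → b i ≡ μ i) → candidate b p ≗ μ
  candidate-≗ {μ} {b} {p} half b≡μ i with i Fin.≟ p
  ... | no i≢p = b≡μ i i≢p
  ... | yes refl = begin
    + n / 2 - (sum b - b p)                    ≡⟨ cong₂ (λ x y → x - (y - b p)) (sym (proj₂ half)) sum-b ⟩
    sum μ - (1ℚ * sum μ + (b p - μ p) * 1ℚ - b p)
      ≡⟨ solve 3 (λ s b m → s :- (con 1ℚ :* s :+ (b :- m) :* con 1ℚ :- b) := m) refl (sum μ) (b p) (μ p) ⟩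
    μ p                                        ∎
    where
    open ≡-Reasoning
    -- Two functions that agree off `p` differ by a multiple of `δ p`, which gives the sum of `b`.
    b-≗ : b ≗ 1ℚ ⟨ μ ⟩+ b p - μ p ⟨ δ p ⟩
    b-≗ j with j Fin.≟ p
    ... | yes refl = solve 2 (λ b m → b := con 1ℚ :* m :+ (b :- m) :* con 1ℚ) refl (b p) (μ p)
    ... | no j≢p = trans (b≡μ j j≢p) (solve 2 (λ m d → m := con 1ℚ :* m :+ d :* con 0ℚ) refl (μ j) (b p - μ p))
    sum-b : sum b ≡ 1ℚ * sum μ + (b p - μ p) * 1ℚ
    sum-b = trans (sum-cong-≗ b-≗) (trans (sum-linear 1ℚ μ (b p - μ p) (δ p))
      (cong (λ x → 1ℚ * sum μ + (b p - μ p) * x) (sum-δ₁ p)))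

  -- The 0-1 vectors are enumerated through `Fin (2 ^ n)`, which makes the search for a minimum
  -- finite.
  allCandidates candidates : List (Fin n → ℚ)
  allCandidates = map (λ (k , p) → candidate (bit ∘ finToFun {2} {n} k) p)
    (cartesianProduct (allFin (2 ℕ.^ n)) (allFin n))
  candidates = filter isHalfℚ? allCandidates

  candidate-below : Fin n → ∀ {μ} → IsHalfℚ μ → ∃[ ν ] ν ∈ candidates × B ν ν ≤ B μ μ
  candidate-below p₀ {μ} half with ν , p , halfν , Bν≤ , rounded ← roundTo n ℕ.≤-refl p₀ half =
    c , ∈-filter⁺ isHalfℚ? (∈-map⁺ _ (∈-cartesianProduct⁺ (∈-allFin k) (∈-allFin p)))
          (IsHalfℚ-resp-≗ (sym ∘ c≗ν) halfν) ,
    subst (_≤ B μ μ) (sym (B-cong c≗ν c≗ν)) Bν≤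
    where
    f : Fin n → Fin 2
    f i with ν i ℚ.≟ 1ℚ
    ... | yes _ = suc zero
    ... | no _  = zero
    bit-f : ∀ i → Is01 (ν i) → bit (f i) ≡ ν i
    bit-f i z with ν i ℚ.≟ 1ℚ | z
    ... | yes νi≡1 | _ = sym νi≡1
    ... | no _ | inj₁ νi≡0 = sym νi≡0
    ... | no νi≢1 | inj₂ νi≡1 = contradiction νi≡1 νi≢1
    -- The rounded half `ν` agrees with the list member `c` only pointwise, so `c` is returned in
    -- its place and the half property and the value of `B` are transported.
    k = funToFin f
    c = candidate (bit ∘ finToFun {2} {n} k) p
    c≗ν : c ≗ ν
    c≗ν = candidate-≗ halfν λ i i≢p →
      trans (cong bit (Fin.finToFun-funToFin f i)) (bit-f i (rounded i (Fin.toℕ<n i) i≢p))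

  minimizer : Fin n → ∃[ μ* ] IsHalfℚ μ* × (∀ μ → IsHalfℚ μ → B μ* μ* ≤ B μ μ)
  minimizer p₀ = minimal-if (argmin Q (λ _ → ½) candidates)
    (argmin-all Q (½-isHalfℚ n) (all-filter isHalfℚ? allCandidates))
    (argmin-≤ Q (λ _ → ½) candidates)
    where
    Q : (Fin n → ℚ) → ℚ
    Q μ = B μ μ
    minimal-if : ∀ μ* → IsHalfℚ μ* → (∀ {ν} → ν ∈ candidates → Q μ* ≤ Q ν) →
      ∃[ μ* ] IsHalfℚ μ* × (∀ μ → IsHalfℚ μ → Q μ* ≤ Q μ)
    minimal-if μ* half* below = μ* , half* , λ μ half →
      let ν , ν∈ , Qν≤ = candidate-below p₀ half in ℚ.≤-trans (below ν∈) Qν≤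

-- Halves with few edges

-- Division enters only through the equation `p * y ≡ x`, so that the ring solver can treat the
-- quotient as a variable.
quotient-of : ∀ {x y} → 0ℚ ≤ x → 0ℚ < y → ∃[ p ] 0ℚ ≤ p × p * y ≡ x
quotient-of {x} {y} 0≤x 0<y = x * 1/ y , 0≤* 0≤x (ℚ.<⇒≤ (ℚ.positive⁻¹ (1/ y))) ,
  trans (ℚ.*-assoc x (1/ y) y) (trans (cong (x *_) (ℚ.*-inverseˡ y)) (ℚ.*-identityʳ x))
  where
  instance
    y+  = positive 0<y
    y≢0 = ℚ.pos⇒nonZero y
    i+  = ℚ.1/pos⇒pos y

*-cancelʳ-≤ : ∀ {p q r} → 0ℚ < r → p * r ≤ q * r → p ≤ q
*-cancelʳ-≤ {r = r} 0<r = ℚ.*-cancelʳ-≤-pos r {{positive 0<r}}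

0<ι : ∀ n .{{_ : NonZero n}} → 0ℚ < ι n
0<ι n@(suc _) = ℚ.positive⁻¹ (ι n) {{ℚ.normalize-pos n 1}}

0<n/2 : ∀ n .{{_ : NonZero n}} → 0ℚ < + n / 2
0<n/2 n@(suc _) = ℚ.positive⁻¹ (+ n / 2) {{ℚ.normalize-pos n 2}}

-- The value `a + p r` lies between `a` and `a + r`.
mix-bounds : ∀ {a r p} → 0ℚ ≤ a → 0ℚ ≤ r → a + r ≤ 1ℚ → 0ℚ ≤ p → p ≤ 1ℚ →
  0ℚ ≤ 1ℚ * a + p * r × 1ℚ * a + p * r ≤ 1ℚ
mix-bounds {a} {r} {p} 0≤a 0≤r a+r≤1 0≤p p≤1 =
  0≤+ (0≤* 0≤1 0≤a) (0≤* 0≤p 0≤r) ,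
  ≤-by-difference
    (solve 3 (λ a r p → con 1ℚ :- (con 1ℚ :* a :+ p :* r) := (con 1ℚ :- (a :+ r)) :+ (con 1ℚ :- p) :* r) refl a r p)
    (0≤+ (p≤q⇒0≤q-p a+r≤1) (0≤* (p≤q⇒0≤q-p p≤1) 0≤r))

-- With X and Y the values 4 Q of the form at the two halves of an edge and c = 1/2 - p,
-- the weighted sum (Z - X) + (1 - 4 c)(Z - Y) is a nonnegative combination of P′ and R.
one-of-two : ∀ {P P′ R p} → 0ℚ ≤ P → 0ℚ ≤ P′ → 0ℚ ≤ R → 0ℚ ≤ p → p ≤ ½ →
  let Z = P + P + (P′ + P′) + R in
  ι 4 * (p * P + p * P + p * p * R) ≤ Z ⊎
  ι 4 * ((1ℚ - p) * P′ + (1ℚ - p) * P′ + (1ℚ - p) * (1ℚ - p) * R) ≤ Z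
one-of-two {P} {P′} {R} {p} 0≤P 0≤P′ 0≤R 0≤p p≤½ with ℚ.≤-total X Z | ℚ.≤-total Y Z
  where
  Z = P + P + (P′ + P′) + R
  X = ι 4 * (p * P + p * P + p * p * R)
  Y = ι 4 * ((1ℚ - p) * P′ + (1ℚ - p) * P′ + (1ℚ - p) * (1ℚ - p) * R)
... | inj₁ X≤Z | _ = inj₁ X≤Z
... | inj₂ _   | inj₁ Y≤Z = inj₂ Y≤Z
... | inj₂ Z≤X | inj₂ Z≤Y with ℚ.≤-total (ι 4 * p) 1ℚ
-- For `p ≤ 1/4` the weight `1 - 4 c = 4 p - 1` is not positive, but then all coefficients of
-- `Z - X` in `P`, `P′` and `R` are nonnegative.
...   | inj₁ 4p≤1 = inj₁ (≤-by-difference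
  (solve 4 (λ P P′ R p →
    P :+ P :+ (P′ :+ P′) :+ R :- con (ι 4) :* (p :* P :+ p :* P :+ p :* p :* R) :=
    con (ι 2) :* (con 1ℚ :- con (ι 4) :* p) :* P :+ con (ι 2) :* P′ :+
    (con (ι 2) :* (con ½ :- p) :* (con 1ℚ :+ con (ι 2) :* p)) :* R) refl P P′ R p)
  (0≤+ (0≤+ (0≤* (0≤* (0≤ι 2) (p≤q⇒0≤q-p 4p≤1)) 0≤P) (0≤* (0≤ι 2) 0≤P′))
    (0≤* (0≤* (0≤* (0≤ι 2) (p≤q⇒0≤q-p p≤½)) (0≤+ 0≤1 (0≤* (0≤ι 2) 0≤p))) 0≤R)))
-- Now the weight is nonnegative and `Z ≤ Y`, so moving the term of `Y` to the other side leaves a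
-- sum of nonnegative terms for `Z - X`.
...   | inj₂ 1≤4p = inj₁ (≤-by-difference
  (solve 4 (λ P P′ R p → let c = con ½ :- p in
    P :+ P :+ (P′ :+ P′) :+ R :- con (ι 4) :* (p :* P :+ p :* P :+ p :* p :* R) :=
    con (ι 32) :* (c :* c) :* P′ :+ (con (ι 8) :* (c :* c) :+ con (ι 16) :* (c :* c :* c)) :* R :+
    (con (ι 4) :* p :- con 1ℚ) :*
      (con (ι 4) :* ((con 1ℚ :- p) :* P′ :+ (con 1ℚ :- p) :* P′ :+ (con 1ℚ :- p) :* (con 1ℚ :- p) :* R)
        :- (P :+ P :+ (P′ :+ P′) :+ R))) refl P P′ R p)
  (0≤+ (0≤+ (0≤* (0≤* (0≤ι 32) 0≤cc) 0≤P′)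
            (0≤* (0≤+ (0≤* (0≤ι 8) 0≤cc) (0≤* (0≤ι 16) (0≤* 0≤cc 0≤c))) 0≤R))
    (0≤* (p≤q⇒0≤q-p 1≤4p) (p≤q⇒0≤q-p Z≤Y))))
  where
  0≤c : 0ℚ ≤ ½ - p
  0≤c = p≤q⇒0≤q-p p≤½
  0≤cc = 0≤* 0≤c 0≤c

module EdgeHalves {n} .{{_ : NonZero n}} (G : Graph n) (triangleFree : TriangleFree G) where

  open BilinearForm G

  𝟏 : Fin n → ℚ
  𝟏 _ = 1ℚ

  A-triangle : ∀ v i j → A i j * (A v i * A v j) ≡ 0ℚ
  A-triangle v i j with adj? G i j | adj? G v i | adj? G v j
  ... | no _   | x      | y      = ℚ.*-zeroˡ (𝟙 x * 𝟙 y)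
  ... | yes _  | no _   | y      = trans (ℚ.*-identityˡ _) (ℚ.*-zeroˡ (𝟙 y))
  ... | yes _  | yes _  | no _   = refl
  ... | yes ij | yes vi | yes vj = contradiction (vi , ij , vj) (triangleFree v i j)

  A-disjoint : ∀ {v w} → Adj G v w → ∀ i → A v i + A w i ≤ 1ℚ
  A-disjoint {v} {w} vw i with adj? G v i | adj? G w i
  ... | no _   | y      = subst (_≤ 1ℚ) (sym (ℚ.+-identityˡ (𝟙 y))) (𝟙≤1 y)
  ... | yes _  | no _   = ℚ.≤-refl
  ... | yes vi | yes wi = contradiction (vw , wi , vi) (triangleFree v w i)

  -- Two adjacent neighbours of `v` would close a triangle.
  B-nbhd : ∀ v → B (A v) (A v) ≡ 0ℚ
  B-nbhd v = trans (sum-cong-≗ λ i → trans (sum-cong-≗ λ j → A-triangle v i j) (sum-zero n)) (sum-zero n)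

  -- The bound `e(μ) ≤ (|E| - e(N(v), N(w))) / 4` without denominators: `B μ μ` is twice the edge
  -- weight `e(μ)`, `B 𝟏 𝟏` is `2 |E|`, and for an edge `vw` the number `B (A v) (A w)` counts the
  -- edges between the two disjoint neighbourhoods.
  GoodHalf : Fin n → Fin n → Set
  GoodHalf v w = ∃[ μ ] IsHalfℚ μ × ι 4 * B μ μ + (B (A v) (A w) + B (A v) (A w)) ≤ B 𝟏 𝟏

  module _ {v w} (vw : Adj G v w) where

    a b r : Fin n → ℚ
    a = A v
    b = A w
    r i = 1ℚ - (a i + b i)

    0≤r : ∀ i → 0ℚ ≤ r i
    0≤r i = p≤q⇒0≤q-p (A-disjoint vw i)

    a+r≤1 : ∀ i → a i + r i ≤ 1ℚ
    a+r≤1 i = ≤-by-difference (solve 2 (λ a b → con 1ℚ :- (a :+ (con 1ℚ :- (a :+ b))) := b) refl (a i) (b i)) (0≤A w i)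

    b+r≤1 : ∀ i → b i + r i ≤ 1ℚ
    b+r≤1 i = ≤-by-difference (solve 2 (λ a b → con 1ℚ :- (b :+ (con 1ℚ :- (a :+ b))) := a) refl (a i) (b i)) (0≤A v i)

    P P′ R : ℚ
    P  = B a r
    P′ = B b r
    R  = B r r

    -- Expands the form along `𝟏 = a + b + r`, where `B a a` and `B b b` vanish. The right side is
    -- the `Z` of `one-of-two`.
    B-𝟏-𝟏 : B 𝟏 𝟏 - (B a b + B a b) ≡ P + P + (P′ + P′) + R
    B-𝟏-𝟏 = trans (cong (_- (B a b + B a b)) (trans (B-cong 𝟏≗ 𝟏≗) (trans (B-quadratic 1ℚ ab 1ℚ r)
        (cong₂ (λ x y → 1ℚ * 1ℚ * x + (1ℚ * 1ℚ * y + 1ℚ * 1ℚ * y) + 1ℚ * 1ℚ * R)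
          (trans (B-quadratic 1ℚ a 1ℚ b)
            (cong₂ (λ x y → 1ℚ * 1ℚ * x + (1ℚ * 1ℚ * B a b + 1ℚ * 1ℚ * B a b) + 1ℚ * 1ℚ * y) (B-nbhd v) (B-nbhd w)))
          (B-linearˡ 1ℚ a 1ℚ b r)))))
      (solve 4 (λ e p q r → let o = con 1ℚ :* con 1ℚ; s = con 1ℚ :* p :+ con 1ℚ :* q in
        (o :* (o :* con 0ℚ :+ (o :* e :+ o :* e) :+ o :* con 0ℚ) :+ (o :* s :+ o :* s) :+ o :* r) :- (e :+ e) :=
        p :+ p :+ (q :+ q) :+ r) refl (B a b) P P′ R)
      where
      ab = 1ℚ ⟨ a ⟩+ 1ℚ ⟨ b ⟩
      𝟏≗ : 𝟏 ≗ 1ℚ ⟨ ab ⟩+ 1ℚ ⟨ r ⟩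
      𝟏≗ i = solve 2 (λ a b → con 1ℚ := con 1ℚ :* (con 1ℚ :* a :+ con 1ℚ :* b) :+ con 1ℚ :* (con 1ℚ :- (a :+ b))) refl (a i) (b i)

    good : ∀ {x} → ι 4 * x ≤ P + P + (P′ + P′) + R → ι 4 * x + (B a b + B a b) ≤ B 𝟏 𝟏
    good {x} le = ≤-by-difference
      (trans (solve 3 (λ o x e → o :- (x :+ e) := (o :- e) :- x) refl (B 𝟏 𝟏) (ι 4 * x) (B a b + B a b))
        (cong (_- ι 4 * x) B-𝟏-𝟏))
      (p≤q⇒0≤q-p le)

    -- With `A v` and `p`, or `A w` and `1ℚ - p`, this yields the two quantities that `one-of-two`
    -- compares with `Z`.
    B-mix : ∀ u (u-indep : B u u ≡ 0ℚ) p → B (1ℚ ⟨ u ⟩+ p ⟨ r ⟩) (1ℚ ⟨ u ⟩+ p ⟨ r ⟩) ≡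
      p * B u r + p * B u r + p * p * R
    B-mix u u-indep p = trans (B-quadratic 1ℚ u p r)
      (trans (cong (λ x → 1ℚ * 1ℚ * x + (1ℚ * p * B u r + 1ℚ * p * B u r) + p * p * R) u-indep)
      (solve 3 (λ p x r → con 1ℚ :* con 1ℚ :* con 0ℚ :+ (con 1ℚ :* p :* x :+ con 1ℚ :* p :* x) :+ p :* p :* r :=
        p :* x :+ p :* x :+ p :* p :* r) refl p (B u r) R))

    h : ℚ
    h = + n / 2

    sum-r : sum r ≡ h + h - (sum a + sum b)
    sum-r = trans (sum-cong-≗ r≗) (trans (sum-linear 1ℚ 𝟏 (- 1ℚ) ab)
      (trans (cong₂ (λ x y → 1ℚ * x + - 1ℚ * y) (trans (sum-const n 1ℚ) (ℚ.*-identityʳ (ι n))) (sum-linear 1ℚ a 1ℚ b))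
      (trans (cong (λ x → 1ℚ * x + - 1ℚ * (1ℚ * sum a + 1ℚ * sum b)) (sym (n/2+n/2≡n n)))
      (solve 3 (λ h a b → con 1ℚ :* (h :+ h) :+ con (- 1ℚ) :* (con 1ℚ :* a :+ con 1ℚ :* b) := h :+ h :- (a :+ b))
        refl h (sum a) (sum b)))))
      where
      ab = 1ℚ ⟨ a ⟩+ 1ℚ ⟨ b ⟩
      r≗ : r ≗ 1ℚ ⟨ 𝟏 ⟩+ - 1ℚ ⟨ ab ⟩
      r≗ i = solve 2 (λ a b → con 1ℚ :- (a :+ b) := con 1ℚ :* con 1ℚ :+ con (- 1ℚ) :* (con 1ℚ :* a :+ con 1ℚ :* b)) refl (a i) (b i)

    good-scaled : h ≤ sum a → ∀ {s} → 0ℚ ≤ s → s * sum a ≡ h → GoodHalf v w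
    good-scaled h≤a {s} 0≤s s*a≡h =
      μ , (bounds , total) , good {B μ μ} (subst (_≤ P + P + (P′ + P′) + R) (sym 4Q≡0)
        (0≤+ (0≤+ (0≤+ 0≤P 0≤P) (0≤+ 0≤P′ 0≤P′)) (0≤B 0≤r 0≤r)))
      where
      0≤P = 0≤B (0≤A v) 0≤r
      0≤P′ = 0≤B (0≤A w) 0≤r
      -- The zero term only brings the multiple of `a` into the shape of `B-quadratic`.
      μ = s ⟨ a ⟩+ 0ℚ ⟨ a ⟩
      μ≡ : ∀ i → μ i ≡ s * a i
      μ≡ i = solve 2 (λ s a → s :* a :+ con 0ℚ :* a := s :* a) refl s (a i)
      s≤1 : s ≤ 1ℚ
      s≤1 = *-cancelʳ-≤ {s} {1ℚ} {sum a} (ℚ.<-≤-trans (0<n/2 n) h≤a)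
        (subst₂ _≤_ (sym s*a≡h) (sym (ℚ.*-identityˡ (sum a))) h≤a)
      bounds : ∀ i → 0ℚ ≤ μ i × μ i ≤ 1ℚ
      bounds i = subst (λ x → 0ℚ ≤ x × x ≤ 1ℚ) (sym (μ≡ i)) (0≤* 0≤s (0≤A v i) ,
        ≤-by-difference (solve 2 (λ s a → con 1ℚ :- s :* a := (con 1ℚ :- s) :+ s :* (con 1ℚ :- a)) refl s (a i))
          (0≤+ (p≤q⇒0≤q-p s≤1) (0≤* 0≤s (p≤q⇒0≤q-p (𝟙≤1 (adj? G v i))))))
      total : sum μ ≡ h
      total = trans (sum-linear s a 0ℚ a) (trans (solve 2 (λ s a → s :* a :+ con 0ℚ :* a := s :* a) refl s (sum a)) s*a≡h)
      4Q≡0 : ι 4 * B μ μ ≡ 0ℚ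
      4Q≡0 = trans (cong (ι 4 *_) (trans (B-quadratic s a 0ℚ a)
          (cong (λ x → s * s * x + (s * 0ℚ * x + s * 0ℚ * x) + 0ℚ * 0ℚ * x) (B-nbhd v))))
        (solve 1 (λ s → con (ι 4) :* (s :* s :* con 0ℚ :+ (s :* con 0ℚ :* con 0ℚ :+ s :* con 0ℚ :* con 0ℚ)
          :+ con 0ℚ :* con 0ℚ :* con 0ℚ) := con 0ℚ) refl s)

    good-large : h ≤ sum a → GoodHalf v w
    good-large h≤a =
      let s , 0≤s , s*a≡h = quotient-of {h} {sum a} (ℚ.<⇒≤ (0<n/2 n)) (ℚ.<-≤-trans (0<n/2 n) h≤a)
      in good-scaled h≤a 0≤s s*a≡h

    -- The two sides differ by `sum a - sum b`. This yields both `p ≤ ½` and, when `N(v)` is smaller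
    -- than `n / 2`, that `sum r` is positive.
    h-a+h-a≤r : sum b ≤ sum a → (h - sum a) + (h - sum a) ≤ sum r
    h-a+h-a≤r b≤a = ≤-by-difference (trans (cong (_- ((h - sum a) + (h - sum a))) sum-r)
      (solve 3 (λ h a b → h :+ h :- (a :+ b) :- ((h :- a) :+ (h :- a)) := a :- b) refl h (sum a) (sum b)))
      (p≤q⇒0≤q-p b≤a)

    good-mix : sum b ≤ sum a → 0ℚ < sum r → ∀ {p} → 0ℚ ≤ p → p * sum r ≡ h - sum a → GoodHalf v w
    good-mix b≤a 0<sum-r {p} 0≤p p*r≡h-a =
      choose (one-of-two {P} {P′} {R} {p} (0≤B (0≤A v) 0≤r) (0≤B (0≤A w) 0≤r) (0≤B 0≤r 0≤r) 0≤p p≤½)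
      where
      p≤½ : p ≤ ½
      p≤½ = *-cancelʳ-≤ {p} {½} {sum r} 0<sum-r (≤-by-difference
        (trans (cong (_-_ (½ * sum r)) p*r≡h-a)
          (solve 2 (λ x r → con ½ :* r :- x := con ½ :* (r :- (x :+ x))) refl (h - sum a) (sum r)))
        (0≤* (ℚ.nonNegative⁻¹ ½) (p≤q⇒0≤q-p (h-a+h-a≤r b≤a))))
      0≤1-p : 0ℚ ≤ 1ℚ - p
      0≤1-p = p≤q⇒0≤q-p (ℚ.≤-trans p≤½ (0≤q-p⇒p≤q {½} {1ℚ} (ℚ.nonNegative⁻¹ ½)))
      μ₁ = 1ℚ ⟨ a ⟩+ p ⟨ r ⟩
      -- This is `𝟏 - μ₁`, the complement of a half.
      μ₂ = 1ℚ ⟨ b ⟩+ 1ℚ - p ⟨ r ⟩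
      half₁ : IsHalfℚ μ₁
      half₁ = (λ i → mix-bounds (0≤A v i) (0≤r i) (a+r≤1 i) 0≤p (0≤q-p⇒p≤q 0≤1-p)) ,
        trans (sum-linear 1ℚ a p r) (trans (cong (_+_ (1ℚ * sum a)) p*r≡h-a)
          (solve 2 (λ a h → con 1ℚ :* a :+ (h :- a) := h) refl (sum a) h))
      half₂ : IsHalfℚ μ₂
      half₂ = (λ i → mix-bounds (0≤A w i) (0≤r i) (b+r≤1 i) 0≤1-p
          (≤-by-difference (solve 1 (λ p → con 1ℚ :- (con 1ℚ :- p) := p) refl p) 0≤p)) ,
        trans (sum-linear 1ℚ b (1ℚ - p) r)
          (trans (solve 3 (λ b r p → con 1ℚ :* b :+ (con 1ℚ :- p) :* r := b :+ r :- p :* r) refl (sum b) (sum r) p)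
          (trans (cong₂ (λ x y → sum b + x - y) sum-r p*r≡h-a)
          (solve 3 (λ a b h → b :+ (h :+ h :- (a :+ b)) :- (h :- a) := h) refl (sum a) (sum b) h)))
      choose : ι 4 * (p * P + p * P + p * p * R) ≤ P + P + (P′ + P′) + R ⊎
               ι 4 * ((1ℚ - p) * P′ + (1ℚ - p) * P′ + (1ℚ - p) * (1ℚ - p) * R) ≤ P + P + (P′ + P′) + R →
               GoodHalf v w
      choose (inj₁ le) = μ₁ , half₁ , good {B μ₁ μ₁}
        (subst (λ x → ι 4 * x ≤ P + P + (P′ + P′) + R) (sym (B-mix a (B-nbhd v) p)) le)
      choose (inj₂ le) = μ₂ , half₂ , good {B μ₂ μ₂}
        (subst (λ x → ι 4 * x ≤ P + P + (P′ + P′) + R) (sym (B-mix b (B-nbhd w) (1ℚ - p))) le)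

    good-small : sum a < h → sum b ≤ sum a → GoodHalf v w
    good-small a<h b≤a =
      let p , 0≤p , p*r≡h-a = quotient-of {h - sum a} {sum r} (ℚ.<⇒≤ 0<h-a) 0<sum-r
      in good-mix b≤a 0<sum-r 0≤p p*r≡h-a
      where
      0<h-a : 0ℚ < h - sum a
      0<h-a = subst (_< h - sum a) (ℚ.+-inverseʳ (sum a)) (ℚ.+-monoˡ-< (- sum a) a<h)
      0<sum-r : 0ℚ < sum r
      0<sum-r = ℚ.<-≤-trans (ℚ.+-mono-< 0<h-a 0<h-a) (h-a+h-a≤r b≤a)

    good-ordered : sum b ≤ sum a → GoodHalf v w
    good-ordered b≤a with h ℚ.≤? sum a
    ... | yes h≤a = good-large h≤a
    ... | no h≰a  = good-small (ℚ.≰⇒> h≰a) b≤a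

  good-half : ∀ {v w} → Adj G v w → GoodHalf v w
  good-half {v} {w} vw with ℚ.≤-total (sum (A w)) (sum (A v))
  ... | inj₁ w≤v = good-ordered vw w≤v
  ... | inj₂ v≤w with μ , half , le ← good-ordered (Graph.Adj-sym G vw) v≤w =
    μ , half , subst (λ e → ι 4 * B μ μ + (e + e) ≤ B 𝟏 𝟏) (B-sym (A w) (A v)) le

  -- The sum of `e(N(v), N(w))` over ordered edges `vw`, which will turn out to be the number of
  -- homomorphisms from the 4-cycle.
  H : ℚ
  H = sum λ v → sum λ w → A v w * B (A v) (A w)

  -- Averages good-half over all ordered edges.
  minimizer-bound : ∀ {μ*} → (∀ μ → IsHalfℚ μ → B μ* μ* ≤ B μ μ) →
    ι 4 * B μ* μ* * B 𝟏 𝟏 + (H + H) ≤ B 𝟏 𝟏 * B 𝟏 𝟏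
  minimizer-bound {μ*} minimal = subst₂ _≤_ lhs rhs (sum-mono λ v → sum-mono λ w → edge v w)
    where
    Q = B μ* μ*
    M = B 𝟏 𝟏
    edge : ∀ v w → A v w * (ι 4 * Q + (B (A v) (A w) + B (A v) (A w))) ≤ A v w * M
    edge v w with adj? G v w
    ... | no _ = ℚ.≤-reflexive (trans (ℚ.*-zeroˡ (ι 4 * Q + (B (A v) (A w) + B (A v) (A w)))) (sym (ℚ.*-zeroˡ M)))
    ... | yes vw with μ , half , le ← good-half vw =
      subst₂ _≤_ (sym (ℚ.*-identityˡ (ι 4 * Q + (B (A v) (A w) + B (A v) (A w))))) (sym (ℚ.*-identityˡ M)) (ℚ.≤-trans
        (ℚ.+-monoˡ-≤ (B (A v) (A w) + B (A v) (A w)) (ℚ.*-monoˡ-≤-nonNeg (ι 4) (minimal μ half))) le)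
    sum-A : ∀ c → sum (λ v → sum λ w → A v w * c) ≡ M * c
    sum-A c = sym (trans (*-distribʳ-sum c (λ v → sum λ w → A v w * (1ℚ * 1ℚ)))
      (sum-cong-≗ λ v → trans (*-distribʳ-sum c (λ w → A v w * (1ℚ * 1ℚ)))
        (sum-cong-≗ λ w → cong (_* c) (ℚ.*-identityʳ (A v w)))))
    rhs : sum (λ v → sum λ w → A v w * M) ≡ M * M
    rhs = sum-A M
    e : Fin n → Fin n → ℚ
    e v w = A v w * B (A v) (A w)
    lhs : sum (λ v → sum λ w → A v w * (ι 4 * Q + (B (A v) (A w) + B (A v) (A w)))) ≡ ι 4 * Q * M + (H + H)
    lhs = trans (sum-cong-≗ λ v → trans
        (sum-cong-≗ λ w → solve 3 (λ a q x → a :* (q :+ (x :+ x)) := con 1ℚ :* (a :* q) :+ con (ι 2) :* (a :* x))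
          refl (A v w) (ι 4 * Q) (B (A v) (A w)))
        (sum-linear 1ℚ (λ w → A v w * (ι 4 * Q)) (ι 2) (e v)))
      (trans (sum-linear 1ℚ (λ v → sum λ w → A v w * (ι 4 * Q)) (ι 2) (λ v → sum (e v)))
      (trans (cong (λ x → 1ℚ * x + ι 2 * H) (sum-A (ι 4 * Q)))
      (solve 3 (λ m q h → con 1ℚ :* (m :* q) :+ con (ι 2) :* h := q :* m :+ (h :+ h)) refl M (ι 4 * Q) H)))

-- Sums over lists and the number of 4-cycles

sumᴸ : ∀ {A : Set} → (A → ℚ) → List A → ℚ
sumᴸ f = foldr (λ x s → f x + s) 0ℚ

sumᴸ-++ : ∀ {A : Set} (f : A → ℚ) xs ys → sumᴸ f (xs ++ ys) ≡ sumᴸ f xs + sumᴸ f ys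
sumᴸ-++ f []       ys = sym (ℚ.+-identityˡ (sumᴸ f ys))
sumᴸ-++ f (x ∷ xs) ys = trans (cong (_+_ (f x)) (sumᴸ-++ f xs ys)) (sym (ℚ.+-assoc (f x) (sumᴸ f xs) (sumᴸ f ys)))

sumᴸ-map : ∀ {A C : Set} (f : C → ℚ) (g : A → C) xs → sumᴸ f (map g xs) ≡ sumᴸ (f ∘ g) xs
sumᴸ-map f g []       = refl
sumᴸ-map f g (x ∷ xs) = cong (_+_ (f (g x))) (sumᴸ-map f g xs)

sumᴸ-cong : ∀ {A : Set} {f g : A → ℚ} → f ≗ g → ∀ xs → sumᴸ f xs ≡ sumᴸ g xs
sumᴸ-cong f≗g []       = refl
sumᴸ-cong f≗g (x ∷ xs) = cong₂ _+_ (f≗g x) (sumᴸ-cong f≗g xs)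

sumᴸ-mono : ∀ {A : Set} {f g : A → ℚ} → (∀ x → f x ≤ g x) → ∀ xs → sumᴸ f xs ≤ sumᴸ g xs
sumᴸ-mono f≤g []       = ℚ.≤-refl
sumᴸ-mono f≤g (x ∷ xs) = ℚ.+-mono-≤ (f≤g x) (sumᴸ-mono f≤g xs)

sumᴸ-+-const : ∀ {A : Set} (f : A → ℚ) c xs → sumᴸ (λ x → f x + c) xs ≡ sumᴸ f xs + ι (length xs) * c
sumᴸ-+-const f c []       = sym (trans (ℚ.+-identityˡ (0ℚ * c)) (ℚ.*-zeroˡ c))
sumᴸ-+-const f c (x ∷ xs) = trans (cong (_+_ (f x + c)) (sumᴸ-+-const f c xs))
  (trans (solve 4 (λ x c s l → x :+ c :+ (s :+ l :* c) := x :+ s :+ (con 1ℚ :+ l) :* c) refl (f x) c (sumᴸ f xs) (ι (length xs)))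
    (cong (λ l → f x + sumᴸ f xs + l * c) (sym (ι-+ 1 (length xs)))))

sumᴸ-one : ∀ {A : Set} (xs : List A) → sumᴸ (λ _ → 1ℚ) xs ≡ ι (length xs)
sumᴸ-one []       = refl
sumᴸ-one (x ∷ xs) = trans (cong (_+_ 1ℚ) (sumᴸ-one xs)) (sym (ι-+ 1 (length xs)))

sumᴸ-filter : ∀ {A : Set} {P : A → Set} (P? : ∀ x → Dec (P x)) f xs →
  sumᴸ f (filter P? xs) ≡ sumᴸ (λ x → 𝟙 (P? x) * f x) xs
sumᴸ-filter P? f []       = refl
sumᴸ-filter P? f (x ∷ xs) with P? x
... | yes _ = cong₂ _+_ (sym (ℚ.*-identityˡ (f x))) (sumᴸ-filter P? f xs)
... | no _  = trans (sumᴸ-filter P? f xs)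
  (sym (trans (cong (_+ rest) (ℚ.*-zeroˡ (f x))) (ℚ.+-identityˡ rest)))
  where rest = sumᴸ (λ x → 𝟙 (P? x) * f x) xs

sumᴸ-cartesianProduct : ∀ {A C : Set} (f : A × C → ℚ) xs ys →
  sumᴸ f (cartesianProduct xs ys) ≡ sumᴸ (λ x → sumᴸ (λ y → f (x , y)) ys) xs
sumᴸ-cartesianProduct f []       ys = refl
sumᴸ-cartesianProduct f (x ∷ xs) ys = trans (sumᴸ-++ f (map (x ,_) ys) (cartesianProduct xs ys))
  (cong₂ _+_ (sumᴸ-map f (x ,_) ys) (sumᴸ-cartesianProduct f xs ys))

sumᴸ-tabulate : ∀ {A : Set} {n} (f : A → ℚ) (g : Fin n → A) → sumᴸ f (tabulate g) ≡ sum (f ∘ g)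
sumᴸ-tabulate {n = zero}  f g = refl
sumᴸ-tabulate {n = suc n} f g = cong (_+_ (f (g zero))) (sumᴸ-tabulate f (g ∘ suc))

sumᴸ-allFin : ∀ {n} (f : Fin n → ℚ) → sumᴸ f (allFin n) ≡ sum f
sumᴸ-allFin f = sumᴸ-tabulate f (λ i → i)

-- Sums over products of index sets and over quadruples

sum-+ : ∀ m {n} (g : Fin (m ℕ.+ n) → ℚ) → sum g ≡ sum (λ i → g (i ↑ˡ n)) + sum (λ j → g (m ↑ʳ j))
sum-+ zero    g = sym (ℚ.+-identityˡ (sum g))
sum-+ (suc m) {n} g = trans (cong (_+_ (g zero)) (sum-+ m (g ∘ suc)))
  (sym (ℚ.+-assoc (g zero) (sum (λ i → g (suc i ↑ˡ n))) (sum (λ j → g (suc m ↑ʳ j)))))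

sum-combine : ∀ m n (g : Fin (m ℕ.* n) → ℚ) → sum g ≡ sum {m} λ i → sum {n} λ j → g (combine i j)
sum-combine zero    n g = refl
sum-combine (suc m) n g = trans (sum-+ n g)
  (cong (_+_ (sum (λ j → g (j ↑ˡ (m ℕ.* n))))) (sum-combine m n (λ k → g (n ↑ʳ k))))

sum-remQuot : ∀ m n (g : Fin m → Fin n → ℚ) →
  sum (λ k → g (quotient {m} n k) (remainder {m} n k)) ≡ sum λ i → sum λ j → g i j
sum-remQuot m n g = trans (sum-combine m n (λ k → g (quotient {m} n k) (remainder {m} n k)))
  (sum-cong-≗ λ i → sum-cong-≗ λ j → cong (λ (x , y) → g x y) (Fin.remQuot-combine i j))

Sum⁴ : ∀ {n} → (Fin n → Fin n → Fin n → Fin n → ℚ) → ℚ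
Sum⁴ g = sum λ a → sum λ b → sum λ c → sum λ d → g a b c d

-- The coordinates of `finToFun k` are quotients of successive remainders of `k`, and each use of
-- `sum-remQuot` splits off one of them.
sum-finToFun₄ : ∀ n (g : Fin n → Fin n → Fin n → Fin n → ℚ) →
  sum (λ k → let v = finToFun {n} {4} k in
    g (v zero) (v (suc zero)) (v (suc (suc zero))) (v (suc (suc (suc zero))))) ≡ Sum⁴ g
sum-finToFun₄ n g = trans (sum-remQuot n (n ℕ.^ 3) (λ a k → g a (q₂ k) (q₁ (r₂ k)) (q₀ (r₁ (r₂ k)))))
  (sum-cong-≗ λ a → trans (sum-remQuot n (n ℕ.^ 2) (λ b k → g a b (q₁ k) (q₀ (r₁ k))))
  (sum-cong-≗ λ b → trans (sum-remQuot n (n ℕ.^ 1) (λ c k → g a b c (q₀ k)))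
  (sum-cong-≗ λ c → trans (sum-remQuot n (n ℕ.^ 0) (λ d _ → g a b c d))
  -- The remaining index lies in `Fin (n ^ 0)`, so its sum is one term plus zero.
  (sum-cong-≗ λ d → ℚ.+-identityʳ (g a b c d)))))
  where
  q₀ : Fin (n ℕ.^ 1) → Fin n
  q₀ = quotient {n} (n ℕ.^ 0)
  q₁ : Fin (n ℕ.^ 2) → Fin n
  q₁ = quotient {n} (n ℕ.^ 1)
  r₁ : Fin (n ℕ.^ 2) → Fin (n ℕ.^ 1)
  r₁ = remainder {n} (n ℕ.^ 1)
  q₂ : Fin (n ℕ.^ 3) → Fin n
  q₂ = quotient {n} (n ℕ.^ 2)
  r₂ : Fin (n ℕ.^ 3) → Fin (n ℕ.^ 2)
  r₂ = remainder {n} (n ℕ.^ 2)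

Sum⁴-swap-cd : ∀ {n} (g : Fin n → Fin n → Fin n → Fin n → ℚ) → Sum⁴ (λ a b c d → g a b d c) ≡ Sum⁴ g
Sum⁴-swap-cd g = sum-cong-≗ λ a → sum-cong-≗ λ b → ∑-comm (λ c d → g a b d c)

Sum⁴-swap-bc : ∀ {n} (g : Fin n → Fin n → Fin n → Fin n → ℚ) → Sum⁴ (λ a b c d → g a c b d) ≡ Sum⁴ g
Sum⁴-swap-bc g = sum-cong-≗ λ a → ∑-comm (λ b c → sum λ d → g a c b d)

Sum⁴-+ : ∀ {n} (f g : Fin n → Fin n → Fin n → Fin n → ℚ) → Sum⁴ (λ a b c d → f a b c d + g a b c d) ≡ Sum⁴ f + Sum⁴ g
Sum⁴-+ f g = trans
  (sum-cong-≗ λ a → trans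
    (sum-cong-≗ λ b → trans
      (sum-cong-≗ λ c → ∑-distrib-+ (f a b c) (g a b c))
      (∑-distrib-+ (λ c → sum (f a b c)) (λ c → sum (g a b c))))
    (∑-distrib-+ (λ b → sum λ c → sum (f a b c)) (λ b → sum λ c → sum (g a b c))))
  (∑-distrib-+ (λ a → sum λ b → sum λ c → sum (f a b c)) (λ a → sum λ b → sum λ c → sum (g a b c)))

-- Samples that induce a 4-cycle

Cyc : (a b c d : Fin 4) → Set
Cyc a b c d = Adj cycle₄ a b × Adj cycle₄ b c × Adj cycle₄ c d × Adj cycle₄ d a

cyc? : ∀ a b c d → Dec (Cyc a b c d)
cyc? a b c d = adj? cycle₄ a b ×-dec adj? cycle₄ b c ×-dec adj? cycle₄ c d ×-dec adj? cycle₄ d a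

-- The three ways to arrange four distinct points in a cycle, according to the point opposite to a.
arrangement : ∀ a b c d → a ≢ b → a ≢ c → a ≢ d → b ≢ c → b ≢ d → c ≢ d →
  Cyc a b c d ⊎ Cyc a b d c ⊎ Cyc a c b d
arrangement = toWitness {a? = Fin.all? λ a → Fin.all? λ b → Fin.all? λ c → Fin.all? λ d →
  ¬? (a Fin.≟ b) →-dec ¬? (a Fin.≟ c) →-dec ¬? (a Fin.≟ d) →-dec ¬? (b Fin.≟ c) →-dec ¬? (b Fin.≟ d) →-dec
  ¬? (c Fin.≟ d) →-dec (cyc? a b c d ⊎-dec cyc? a b d c ⊎-dec cyc? a c b d)} _

module C₄Count {n} (G : Graph n) where

  open BilinearForm G

  cyc : (a b c d : Fin n) → ℚ
  cyc a b c d = A a b * A b c * (A c d * A d a)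

  0≤cyc : ∀ a b c d → 0ℚ ≤ cyc a b c d
  0≤cyc a b c d = 0≤* (0≤* (0≤A a b) (0≤A b c)) (0≤* (0≤A c d) (0≤A d a))

  cyc-yes : ∀ {a b c d} → Adj G a b → Adj G b c → Adj G c d → Adj G d a → cyc a b c d ≡ 1ℚ
  cyc-yes {a} {b} {c} {d} ab bc cd da = cong₂ _*_
    (cong₂ _*_ (𝟙-yes (adj? G a b) ab) (𝟙-yes (adj? G b c) bc))
    (cong₂ _*_ (𝟙-yes (adj? G c d) cd) (𝟙-yes (adj? G d a) da))

  cyc₃ : (a b c d : Fin n) → ℚ
  cyc₃ a b c d = cyc a b c d + (cyc a b d c + cyc a c b d)

  0≤cyc₃ : ∀ a b c d → 0ℚ ≤ cyc₃ a b c d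
  0≤cyc₃ a b c d = 0≤+ (0≤cyc a b c d) (0≤+ (0≤cyc a b d c) (0≤cyc a c b d))

  -- The isomorphism `f` takes four distinct values, which `arrangement` orders into a cycle. Its
  -- edges pull back along `f` to edges between the sampled vertices.
  1≤cyc₃ : ∀ (v : Fin 4 → Fin n) → sampleGraph G v ≅ cycle₄ → 1ℚ ≤ cyc₃ (v 0F) (v 1F) (v 2F) (v 3F)
  1≤cyc₃ v (f , (injective , _) , preserves) = cases (arrangement (f 0F) (f 1F) (f 2F) (f 3F)
    (distinct λ ()) (distinct λ ()) (distinct λ ()) (distinct λ ()) (distinct λ ()) (distinct λ ()))
    where
    distinct : ∀ {i j} → i ≢ j → f i ≢ f j
    distinct i≢j fi≡fj = i≢j (injective fi≡fj)
    back : ∀ {i j} → Adj cycle₄ (f i) (f j) → Adj G (v i) (v j)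
    back {i} {j} = Equivalence.from (preserves i j)
    C₁ = cyc (v 0F) (v 1F) (v 2F) (v 3F)
    C₂ = cyc (v 0F) (v 1F) (v 3F) (v 2F)
    C₃ = cyc (v 0F) (v 2F) (v 1F) (v 3F)
    0≤C₁ = 0≤cyc (v 0F) (v 1F) (v 2F) (v 3F)
    0≤C₂ = 0≤cyc (v 0F) (v 1F) (v 3F) (v 2F)
    0≤C₃ = 0≤cyc (v 0F) (v 2F) (v 1F) (v 3F)
    cases : Cyc (f 0F) (f 1F) (f 2F) (f 3F) ⊎ Cyc (f 0F) (f 1F) (f 3F) (f 2F) ⊎ Cyc (f 0F) (f 2F) (f 1F) (f 3F) →
      1ℚ ≤ C₁ + (C₂ + C₃)
    cases (inj₁ (x , y , z , w)) = ≤-by-difference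
      (trans (cong (λ c → c + (C₂ + C₃) - 1ℚ) (cyc-yes (back {0F} {1F} x) (back {1F} {2F} y) (back {2F} {3F} z) (back {3F} {0F} w)))
        (solve 2 (λ x y → con 1ℚ :+ (x :+ y) :- con 1ℚ := x :+ y) refl C₂ C₃)) (0≤+ 0≤C₂ 0≤C₃)
    cases (inj₂ (inj₁ (x , y , z , w))) = ≤-by-difference
      (trans (cong (λ c → C₁ + (c + C₃) - 1ℚ) (cyc-yes (back {0F} {1F} x) (back {1F} {3F} y) (back {3F} {2F} z) (back {2F} {0F} w)))
        (solve 2 (λ x y → x :+ (con 1ℚ :+ y) :- con 1ℚ := x :+ y) refl C₁ C₃)) (0≤+ 0≤C₁ 0≤C₃)
    cases (inj₂ (inj₂ (x , y , z , w))) = ≤-by-difference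
      (trans (cong (λ c → C₁ + (C₂ + c) - 1ℚ) (cyc-yes (back {0F} {2F} x) (back {2F} {1F} y) (back {1F} {3F} z) (back {3F} {0F} w)))
        (solve 2 (λ x y → x :+ (y :+ con 1ℚ) :- con 1ℚ := x :+ y) refl C₁ C₂)) (0≤+ 0≤C₁ 0≤C₂)

  hom : ℚ
  hom = Sum⁴ cyc

  C₄-sample? : (k : Fin (n ℕ.^ 4)) → Dec (sampleGraph G (finToFun {n} {4} k) ≅ cycle₄)
  C₄-sample? k = sampleGraph G (finToFun {n} {4} k) ≅? cycle₄

  -- Every sample counted on the left contributes to one of three cyclic orders, and permuting the
  -- coordinates shows that each order sums to `hom`. Degenerate closed walks also count in `hom`,
  -- hence only an inequality.
  count≤3hom : ι (length (filter C₄-sample? (allFin (n ℕ.^ 4)))) ≤ ι 3 * hom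
  count≤3hom = begin
    ι (length (filter C₄-sample? (allFin (n ℕ.^ 4))))      ≡⟨ sumᴸ-one (filter C₄-sample? (allFin (n ℕ.^ 4))) ⟨
    sumᴸ (λ _ → 1ℚ) (filter C₄-sample? (allFin (n ℕ.^ 4))) ≡⟨ sumᴸ-filter C₄-sample? (λ _ → 1ℚ) (allFin (n ℕ.^ 4)) ⟩
    sumᴸ (λ k → 𝟙 (C₄-sample? k) * 1ℚ) (allFin (n ℕ.^ 4))  ≡⟨ sumᴸ-allFin (λ k → 𝟙 (C₄-sample? k) * 1ℚ) ⟩
    sum (λ k → 𝟙 (C₄-sample? k) * 1ℚ)                      ≤⟨ sum-mono bound ⟩
    sum (λ k → let v = finToFun {n} {4} k in cyc₃ (v 0F) (v 1F) (v 2F) (v 3F)) ≡⟨ sum-finToFun₄ n cyc₃ ⟩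
    Sum⁴ cyc₃                                              ≡⟨ Sum⁴-+ cyc (λ a b c d → cyc a b d c + cyc a c b d) ⟩
    hom + Sum⁴ (λ a b c d → cyc a b d c + cyc a c b d)
      ≡⟨ cong (_+_ hom) (trans (Sum⁴-+ (λ a b c d → cyc a b d c) (λ a b c d → cyc a c b d))
           (cong₂ _+_ (Sum⁴-swap-cd cyc) (Sum⁴-swap-bc cyc))) ⟩
    hom + (hom + hom)                                      ≡⟨ solve 1 (λ h → h :+ (h :+ h) := con (ι 3) :* h) refl hom ⟩
    ι 3 * hom                                              ∎
    where
    open ℚ.≤-Reasoning
    bound : ∀ k → 𝟙 (C₄-sample? k) * 1ℚ ≤ let v = finToFun {n} {4} k in cyc₃ (v 0F) (v 1F) (v 2F) (v 3F)
    bound k = bound-for (C₄-sample? k)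
      where
      v = finToFun {n} {4} k
      bound-for : (s : Dec (sampleGraph G v ≅ cycle₄)) → 𝟙 s * 1ℚ ≤ cyc₃ (v 0F) (v 1F) (v 2F) (v 3F)
      bound-for (yes iso) = 1≤cyc₃ v iso
      bound-for (no _)    = 0≤cyc₃ (v 0F) (v 1F) (v 2F) (v 3F)

  -- An edge `vw` with adjacent `i` in `N(v)` and `j` in `N(w)` is the closed walk `v w j i`, so the
  -- summand is `cyc` with its last two arguments exchanged.
  nbhd-sum≡hom : sum (λ v → sum λ w → A v w * B (A v) (A w)) ≡ hom
  nbhd-sum≡hom = trans
    (sum-cong-≗ λ v → sum-cong-≗ λ w → trans (*-distribˡ-sum (A v w) (λ i → sum λ j → A i j * (A v i * A w j)))
      (sum-cong-≗ λ i → trans (*-distribˡ-sum (A v w) (λ j → A i j * (A v i * A w j)))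
        (sum-cong-≗ λ j → trans
          (solve 4 (λ x y z t → x :* (y :* (z :* t)) := x :* t :* (y :* z)) refl (A v w) (A i j) (A v i) (A w j))
          (cong (λ x → A v w * A w j * x) (cong₂ _*_ (A-sym i j) (A-sym v i))))))
    (Sum⁴-swap-cd cyc)

  -- One copy of the sum accounts for the pairs `i < j`, the other, with indices exchanged, for
  -- `j < i`. The diagonal contributes nothing since `A` vanishes there.
  sumᴸ-edges : ∀ (K : Fin n → Fin n → ℚ) → (∀ i j → K i j ≡ K j i) →
    sumᴸ (λ (i , j) → K i j) (edges G) + sumᴸ (λ (i , j) → K i j) (edges G) ≡ sum λ i → sum λ j → A i j * K i j
  sumᴸ-edges K K-sym = begin
    S + S                                              ≡⟨ cong₂ _+_ S≡T (trans S≡T (∑-comm T)) ⟩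
    (sum λ i → sum λ j → T i j) + (sum λ i → sum λ j → T j i)
      ≡⟨ ∑-distrib-+ (λ i → sum λ j → T i j) (λ i → sum λ j → T j i) ⟨
    (sum λ i → (sum λ j → T i j) + (sum λ j → T j i))  ≡⟨ sum-cong-≗ (λ i → ∑-distrib-+ (λ j → T i j) (λ j → T j i)) ⟨
    (sum λ i → sum λ j → T i j + T j i)                ≡⟨ (sum-cong-≗ λ i → sum-cong-≗ λ j → both i j) ⟩
    (sum λ i → sum λ j → A i j * K i j)                ∎
    where
    open ≡-Reasoning
    edge? : (e : Fin n × Fin n) → Dec (proj₁ e Fin.< proj₂ e × Adj G (proj₁ e) (proj₂ e))
    edge? (i , j) = (i Fin.<? j) ×-dec adj? G i j
    S = sumᴸ (λ (i , j) → K i j) (edges G)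
    T : Fin n → Fin n → ℚ
    T i j = 𝟙 (edge? (i , j)) * K i j
    S≡T : S ≡ sum λ i → sum λ j → T i j
    S≡T = trans (sumᴸ-filter edge? (λ (i , j) → K i j) (cartesianProduct (allFin n) (allFin n)))
      (trans (sumᴸ-cartesianProduct (λ (i , j) → T i j) (allFin n) (allFin n))
      (trans (sumᴸ-cong (λ i → sumᴸ-allFin (λ j → T i j)) (allFin n))
      (sumᴸ-allFin (λ i → sum λ j → T i j))))
    both : ∀ i j → T i j + T j i ≡ A i j * K i j
    both i j with Fin.<-cmp i j
    ... | tri< i<j _ j≮i = trans
      (cong₂ _+_ (cong (_* K i j) ind) (trans (cong (_* K j i) (𝟙-no (edge? (j , i)) (j≮i ∘ proj₁))) (ℚ.*-zeroˡ (K j i))))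
      (ℚ.+-identityʳ (A i j * K i j))
      where
      ind : 𝟙 (edge? (i , j)) ≡ A i j
      ind with adj? G i j
      ... | yes ij = 𝟙-yes ((i Fin.<? j) ×-dec yes ij) (i<j , ij)
      ... | no ¬ij = 𝟙-no ((i Fin.<? j) ×-dec no ¬ij) (¬ij ∘ proj₂)
    ... | tri> i≮j _ j<i = trans
      (cong₂ _+_ (trans (cong (_* K i j) (𝟙-no (edge? (i , j)) (i≮j ∘ proj₁))) (ℚ.*-zeroˡ (K i j)))
        (cong₂ _*_ (trans ind (A-sym j i)) (K-sym j i)))
      (ℚ.+-identityˡ (A i j * K i j))
      where
      ind : 𝟙 (edge? (j , i)) ≡ A j i
      ind with adj? G j i
      ... | yes ji = 𝟙-yes ((j Fin.<? i) ×-dec yes ji) (j<i , ji)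
      ... | no ¬ji = 𝟙-no ((j Fin.<? i) ×-dec no ¬ji) (¬ji ∘ proj₂)
    ... | tri≈ i≮i refl _ = trans
      (cong (λ x → x * K i i + x * K i i) (𝟙-no (edge? (i , i)) (i≮i ∘ proj₁)))
      (trans (solve 1 (λ k → con 0ℚ :* k :+ con 0ℚ :* k := con 0ℚ :* k) refl (K i i))
        (cong (_* K i i) (sym (A-irrefl i))))

-- From rational to real halves

0≤p*p : ∀ p → 0ℚ ≤ p * p
0≤p*p p with ℚ.≤-total 0ℚ p
... | inj₁ 0≤p = 0≤* 0≤p 0≤p
... | inj₂ p≤0 = subst (0ℚ ≤_) (solve 1 (λ p → (con 0ℚ :- p) :* (con 0ℚ :- p) := p :* p) refl p)
  (0≤* (p≤q⇒0≤q-p p≤0) (p≤q⇒0≤q-p p≤0))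

p≤∣p∣ : ∀ p → p ≤ ∣ p ∣
p≤∣p∣ p with ℚ.∣p∣≡p∨∣p∣≡-p p
... | inj₁ eq = ℚ.≤-reflexive (sym eq)
... | inj₂ eq = ≤-by-difference (cong (_+_ ∣ p ∣) (sym eq)) (0≤+ (ℚ.0≤∣p∣ p) (ℚ.0≤∣p∣ p))

∣p-q∣≤r⇒p≤q+r : ∀ {p q r} → ∣ p - q ∣ ≤ r → p ≤ q + r
∣p-q∣≤r⇒p≤q+r {p} {q} {r} le = ≤-by-difference
  (solve 3 (λ p q r → q :+ r :- p := r :- (p :- q)) refl p q r)
  (p≤q⇒0≤q-p (ℚ.≤-trans (p≤∣p∣ (p - q)) le))

∣p-q∣≤r⇒q≤p+r : ∀ {p q r} → ∣ p - q ∣ ≤ r → q ≤ p + r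
∣p-q∣≤r⇒q≤p+r {p} {q} {r} le = ∣p-q∣≤r⇒p≤q+r (subst (_≤ r)
  (trans (sym (ℚ.∣-p∣≡∣p∣ (p - q))) (cong ∣_∣ (solve 2 (λ p q → :- (p :- q) := q :- p) refl p q))) le)

double-cancel-≤ : ∀ {p q} → p + p ≤ q + q → p ≤ q
double-cancel-≤ {p} {q} le = ≤-by-difference
  (solve 2 (λ p q → q :- p := con ½ :* (q :+ q :- (p :+ p))) refl p q)
  (0≤* (ℚ.nonNegative⁻¹ ½) (p≤q⇒0≤q-p le))

-- Writing `κ` as `(κ + 3 η) - 3 η`, the only loss is `3 η c (x + y)`. It is at most `6 η c`, as
-- `x + y ≤ 2`, and this is at most `12 η`, as `4 η ≤ 1` gives `c ≤ 2`.
product-perturb : ∀ {x y η κ} → 0ℚ ≤ x → x ≤ 1ℚ → 0ℚ ≤ y → y ≤ 1ℚ →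
  0ℚ ≤ η → ι 4 * η ≤ 1ℚ → 0ℚ ≤ κ + ι 3 * η →
  let c = 1ℚ + ι 4 * η in x * y ≤ (c * x + κ) * (c * y + κ) + ι 12 * η
product-perturb {x} {y} {η} {κ} 0≤x x≤1 0≤y y≤1 0≤η 4η≤1 0≤κ+3η = ≤-by-difference
  (solve 4 (λ x y η κ → let c = con 1ℚ :+ con (ι 4) :* η in
    (c :* x :+ κ) :* (c :* y :+ κ) :+ con (ι 12) :* η :- x :* y :=
    (con (ι 8) :* η :+ con (ι 16) :* (η :* η)) :* (x :* y) :+ κ :* κ :+
    c :* (κ :+ con (ι 3) :* η) :* (x :+ y) :+
    con (ι 3) :* η :* c :* ((con 1ℚ :- x) :+ (con 1ℚ :- y)) :+
    con (ι 6) :* η :* (con 1ℚ :- con (ι 4) :* η)) refl x y η κ)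
  (0≤+ (0≤+ (0≤+ (0≤+
    (0≤* (0≤+ (0≤* (0≤ι 8) 0≤η) (0≤* (0≤ι 16) (0≤* 0≤η 0≤η))) (0≤* 0≤x 0≤y))
    (0≤p*p κ))
    (0≤* (0≤* 0≤c 0≤κ+3η) (0≤+ 0≤x 0≤y)))
    (0≤* (0≤* (0≤* (0≤ι 3) 0≤η) 0≤c) (0≤+ (p≤q⇒0≤q-p x≤1) (p≤q⇒0≤q-p y≤1))))
    (0≤* (0≤* (0≤ι 6) 0≤η) (p≤q⇒0≤q-p 4η≤1)))
  where
  0≤c : 0ℚ ≤ 1ℚ + ι 4 * η
  0≤c = 0≤+ 0≤1 (0≤* (0≤ι 4) 0≤η)

-- An almost half m is moved to the half ν with (1 + 4 η)(ν - 1/2) = m - avg, where avg is the mean of m.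
module AlmostHalf {n} .{{_ : NonZero n}} (m : Fin n → ℚ) {η : ℚ} (0≤η : 0ℚ ≤ η) (4η≤1 : ι 4 * η ≤ 1ℚ)
  (0≤m+η : ∀ v → 0ℚ ≤ m v + η) (m≤1+η : ∀ v → m v ≤ 1ℚ + η)
  (sum≤ : sum m ≤ + n / 2 + η) (≤sum : + n / 2 ≤ sum m + η) where

  c s 1/c 1/n avg κ : ℚ
  -- The values of `m` exceed the unit interval by at most `η` and `avg` is within `η` of `½`, so
  -- `m - avg` lies within `½ + 2 η = ½ c` of zero. Division by `c` brings it within `½`.
  c = 1ℚ + ι 4 * η
  0<c : 0ℚ < c
  0<c = ℚ.+-mono-<-≤ (ℚ.positive⁻¹ 1ℚ) (0≤* (0≤ι 4) 0≤η)
  1/c = proj₁ (quotient-of 0≤1 0<c)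
  1/c*c≡1 : 1/c * c ≡ 1ℚ
  1/c*c≡1 = proj₂ (proj₂ (quotient-of 0≤1 0<c))
  1/n = proj₁ (quotient-of 0≤1 (0<ι n))
  0≤1/n : 0ℚ ≤ 1/n
  0≤1/n = proj₁ (proj₂ (quotient-of 0≤1 (0<ι n)))
  1/n*n≡1 : 1/n * ι n ≡ 1ℚ
  1/n*n≡1 = proj₂ (proj₂ (quotient-of 0≤1 (0<ι n)))
  s = sum m
  avg = 1/n * s
  κ = avg - ½ * c

  1/n*n/2≡½ : 1/n * (+ n / 2) ≡ ½
  1/n*n/2≡½ = trans (solve 2 (λ i h → i :* h := con ½ :* (i :* (h :+ h))) refl 1/n (+ n / 2))
    (trans (cong (λ x → ½ * (1/n * x)) (n/2+n/2≡n n)) (cong (½ *_) 1/n*n≡1))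

  1/n≤1 : 1/n ≤ 1ℚ
  1/n≤1 = *-cancelʳ-≤ {1/n} {1ℚ} (0<ι n) (subst₂ _≤_ (sym 1/n*n≡1) (sym (ℚ.*-identityˡ (ι n))) (1≤ι n))
    where
    1≤ι : ∀ n .{{_ : NonZero n}} → 1ℚ ≤ ι n
    1≤ι (suc k) = subst (1ℚ ≤_) (sym (ι-+ 1 k)) (≤-by-difference (solve 1 (λ k → con 1ℚ :+ k :- con 1ℚ := k) refl (ι k)) (0≤ι k))

  -- The error `η` of the sum becomes `η / n` in the mean.
  avg≤ : avg ≤ ½ + η
  avg≤ = ≤-by-difference
    (trans (cong (λ x → x + η - avg) (sym 1/n*n/2≡½))
      (solve 4 (λ i h e s → i :* h :+ e :- i :* s := i :* (h :+ e :- s) :+ (con 1ℚ :- i) :* e) refl 1/n (+ n / 2) η s))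
    (0≤+ (0≤* 0≤1/n (p≤q⇒0≤q-p sum≤)) (0≤* (p≤q⇒0≤q-p 1/n≤1) 0≤η))

  ≤avg : ½ ≤ avg + η
  ≤avg = ≤-by-difference
    (trans (cong (λ x → avg + η - x) (sym 1/n*n/2≡½))
      (solve 4 (λ i h e s → i :* s :+ e :- i :* h := i :* (s :+ e :- h) :+ (con 1ℚ :- i) :* e) refl 1/n (+ n / 2) η s))
    (0≤+ (0≤* 0≤1/n (p≤q⇒0≤q-p ≤sum)) (0≤* (p≤q⇒0≤q-p 1/n≤1) 0≤η))

  0≤κ+3η : 0ℚ ≤ κ + ι 3 * η
  0≤κ+3η = subst (0ℚ ≤_)
    (solve 2 (λ a e → a :+ e :- con ½ := a :- con ½ :* (con 1ℚ :+ con (ι 4) :* e) :+ con (ι 3) :* e) refl avg η)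
    (p≤q⇒0≤q-p ≤avg)

  ν : Fin n → ℚ
  ν = 1/c ⟨ m ⟩+ - κ ⟨ (λ _ → 1/c) ⟩

  c*ν : ∀ v → c * ν v ≡ m v - κ
  c*ν v = trans (solve 4 (λ c i m k → c :* (i :* m :+ (:- k) :* i) := i :* c :* (m :- k)) refl c 1/c (m v) κ)
    (trans (cong (_* (m v - κ)) 1/c*c≡1) (ℚ.*-identityˡ (m v - κ)))

  m≡ : ∀ v → m v ≡ c * ν v + κ
  m≡ v = trans (solve 2 (λ m k → m := m :- k :+ k) refl (m v) κ) (cong (_+ κ) (sym (c*ν v)))

  0≤ν : ∀ v → 0ℚ ≤ ν v
  0≤ν v = *-cancelʳ-≤ {0ℚ} {ν v} 0<c (≤-by-difference
    (trans (solve 2 (λ x c → x :* c :- con 0ℚ :* c := c :* x) refl (ν v) c) (trans (c*ν v)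
      (solve 3 (λ m a e → m :- (a :- con ½ :* (con 1ℚ :+ con (ι 4) :* e)) := (m :+ e) :+ (con ½ :+ e :- a)) refl (m v) avg η)))
    (0≤+ (0≤m+η v) (p≤q⇒0≤q-p avg≤)))

  ν≤1 : ∀ v → ν v ≤ 1ℚ
  ν≤1 v = *-cancelʳ-≤ {ν v} {1ℚ} 0<c (≤-by-difference
    (trans (solve 2 (λ x c → con 1ℚ :* c :- x :* c := c :- c :* x) refl (ν v) c) (trans (cong (_-_ c) (c*ν v))
      (solve 3 (λ m a e → let c = con 1ℚ :+ con (ι 4) :* e in
        c :- (m :- (a :- con ½ :* c)) := (con 1ℚ :+ e :- m) :+ (a :+ e :- con ½)) refl (m v) avg η)))
    (0≤+ (p≤q⇒0≤q-p (m≤1+η v)) (p≤q⇒0≤q-p ≤avg)))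

  sum-ν : sum ν ≡ + n / 2
  sum-ν = trans (sum-linear 1/c m (- κ) (λ _ → 1/c)) (trans (cong (λ x → 1/c * s + - κ * x) (sum-const n 1/c))
    (trans (solve 5 (λ j s i n c → j :* s :+ (:- (i :* s :- con ½ :* c)) :* (n :* j) :=
        j :* s :- i :* n :* (j :* s) :+ con ½ :* (j :* c) :* n) refl 1/c s 1/n (ι n) c)
    (trans (cong₂ (λ x y → 1/c * s - x * (1/c * s) + ½ * y * ι n) 1/n*n≡1 1/c*c≡1)
    (trans (solve 2 (λ x n → x :- con 1ℚ :* x :+ con ½ :* con 1ℚ :* n := con ½ :* n) refl (1/c * s) (ι n))
    (trans (cong (½ *_) (sym (n/2+n/2≡n n))) (solve 1 (λ h → con ½ :* (h :+ h) := h) refl (+ n / 2)))))))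

  isHalf : IsHalfℚ ν
  isHalf = (λ v → 0≤ν v , ν≤1 v) , sum-ν

  ν*ν≤ : ∀ u v → ν u * ν v ≤ m u * m v + ι 12 * η
  ν*ν≤ u v = subst₂ (λ x y → ν u * ν v ≤ x * y + ι 12 * η) (sym (m≡ u)) (sym (m≡ v))
    (product-perturb (0≤ν u) (ν≤1 u) (0≤ν v) (ν≤1 v) 0≤η 4η≤1 0≤κ+3η)

nearby-half : ∀ {n} .{{_ : NonZero n}} {m : Fin n → ℚ} {η} → 0ℚ ≤ η → ι 4 * η ≤ 1ℚ →
  (∀ v → 0ℚ ≤ m v + η) → (∀ v → m v ≤ 1ℚ + η) → ∣ sum m - + n / 2 ∣ ≤ η →
  ∃[ ν ] IsHalfℚ ν × (∀ u v → ν u * ν v ≤ m u * m v + ι 12 * η)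
nearby-half {m = m} 0≤η 4η≤1 low high close = ν , isHalf , ν*ν≤
  where open AlmostHalf m 0≤η 4η≤1 low high (∣p-q∣≤r⇒p≤q+r {sum m} close) (∣p-q∣≤r⇒q≤p+r {sum m} close)

small-enough : ∀ {K ε} → 0ℚ ≤ K → 0ℚ < ε → ∃[ η ] 0ℚ < η × ι 4 * η ≤ 1ℚ × K * η ≤ ε
small-enough {K} {ε} 0≤K 0<ε = from-quotient (quotient-of (ℚ.<⇒≤ 0<ε) 0<D)
  where
  0<4ε : 0ℚ < ι 4 * ε
  0<4ε = ℚ.positive⁻¹ (ι 4 * ε) {{ℚ.pos*pos⇒pos (ι 4) ε {{positive 0<ε}}}}
  -- With `η = ε / D` both `K η ≤ ε` and `4 η ≤ 1` hold, and `D` is positive even when `K` is zero.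
  D = K + ι 4 * ε
  0<D : 0ℚ < D
  0<D = ℚ.+-mono-≤-< 0≤K 0<4ε
  from-quotient : ∃[ η ] 0ℚ ≤ η × η * D ≡ ε → ∃[ η ] 0ℚ < η × ι 4 * η ≤ 1ℚ × K * η ≤ ε
  from-quotient (η , 0≤η , η*D≡ε) = η ,
    ℚ.*-cancelʳ-<-nonNeg D {{nonNegative (ℚ.<⇒≤ 0<D)}} (subst₂ _<_ (sym (ℚ.*-zeroˡ D)) (sym η*D≡ε) 0<ε) ,
    *-cancelʳ-≤ {ι 4 * η} {1ℚ} 0<ε (≤-by-difference
      (trans (cong (λ x → 1ℚ * x - ι 4 * η * ε) (sym η*D≡ε))
        (solve 3 (λ h x e → con 1ℚ :* (h :* (x :+ con (ι 4) :* e)) :- con (ι 4) :* h :* e := h :* x) refl η K ε))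
      (0≤* 0≤η 0≤K)) ,
    ≤-by-difference (trans (cong (_- K * η) (sym η*D≡ε))
        (solve 3 (λ h x e → h :* (x :+ con (ι 4) :* e) :- x :* h := h :* (con (ι 4) :* e)) refl η K ε))
      (0≤* 0≤η (ℚ.<⇒≤ 0<4ε))

scale-error : ∀ {i t m η ε x y} → 0ℚ ≤ i → i * (m * t) * η ≤ ε → x ≤ y + m * (t * η) → i * x ≤ i * y + ε
scale-error {i} {t} {m} {η} {ε} {x} {y} 0≤i small x≤ = ≤-by-difference
  (solve 7 (λ i x y m t h e → i :* y :+ e :- i :* x := i :* (y :+ m :* (t :* h) :- x) :+ (e :- i :* (m :* t) :* h))
    refl i x y m t η ε)
  (0≤+ (0≤* 0≤i (p≤q⇒0≤q-p x≤)) (p≤q⇒0≤q-p small))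

-- Termwise evaluation of real sums and constants

seq-sumᴿ : ∀ {A : Set} (g : A → ℝ) xs k → seq (sumᴿ (map g xs)) k ≡ sumᴸ (λ x → seq (g x) k) xs
seq-sumᴿ g []       k = refl
seq-sumᴿ g (x ∷ xs) k = cong (_+_ (seq (g x) k)) (seq-sumᴿ g xs k)

eventually-all : ∀ {n} {P : Fin n → ℕ → Set} → (∀ v → ∃[ N ] ∀ k → N ℕ.≤ k → P v k) →
  ∃[ N ] ∀ k → N ℕ.≤ k → ∀ v → P v k
eventually-all {zero}  _ = 0 , λ _ _ ()
eventually-all {suc n} {P} ev with N , h ← ev zero | M , g ← eventually-all {n} {P ∘ suc} (ev ∘ suc) =
  N ℕ.⊔ M , λ k le → λ { zero → h k (ℕ.m⊔n≤o⇒m≤o N M le) ; (suc v) → g k (ℕ.m⊔n≤o⇒n≤o N M le) v }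

embed : ∀ {n} → (Fin n → ℚ) → Fin n → ℝ
embed μ v = fromℚ (μ v)

≤⇒≤ᴿ : ∀ {x q} p → (∀ k → seq x k ≡ p) → p ≤ q → x ≤ᴿ fromℚ q
≤⇒≤ᴿ {x} {q} p x≡p p≤q ε 0<ε = 0 , λ k _ → subst (_≤ q + ε) (sym (x≡p k))
  (≤-by-difference (solve 3 (λ p q e → q :+ e :- p := q :- p :+ e) refl p q ε) (0≤+ (p≤q⇒0≤q-p p≤q) (ℚ.<⇒≤ 0<ε)))

fromℚ-mono : ∀ {p q} → p ≤ q → fromℚ p ≤ᴿ fromℚ q
fromℚ-mono {p} = ≤⇒≤ᴿ {fromℚ p} p (λ _ → refl)

≈ᴿ-reflexive : ∀ x y → (∀ k → seq x k ≡ seq y k) → x ≈ᴿ y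
≈ᴿ-reflexive x y x≡y ε 0<ε = 0 , λ k _ → subst (_≤ ε)
  (sym (cong ∣_∣ (trans (cong (_- seq y k) (x≡y k)) (ℚ.+-inverseʳ (seq y k))))) (ℚ.<⇒≤ 0<ε)

÷-*-cancel : ∀ p q .{{_ : ℚ.NonZero q}} → p ÷ q * q ≡ p
÷-*-cancel p q = trans (ℚ.*-assoc p (1/ q) q) (trans (cong (p *_) (ℚ.*-inverseˡ q)) (ℚ.*-identityʳ p))

-- Densities and the bound on the minimum

module Density {n} .{{n≢0 : NonZero n}} (G : Graph n) where

  open BilinearForm G
  open C₄Count G

  instance
    n²≢0 : NonZero (n ℕ.^ 2)
    n²≢0 = ℕ.m^n≢0 n 2
    n⁴≢0 : NonZero (n ℕ.^ 4)
    n⁴≢0 = ℕ.m^n≢0 n 4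

  1/n² |E| #C₄ : ℚ
  1/n² = + 1 / n ℕ.^ 2
  |E|  = ι (length (edges G))
  #C₄  = ι (length (filter C₄-sample? (allFin (n ℕ.^ 4))))

  0≤1/n² : 0ℚ ≤ 1/n²
  0≤1/n² = ℚ.nonNegative⁻¹ 1/n² {{ℚ.normalize-nonNeg 1 (n ℕ.^ 2)}}

  1/n²-cancel : 1/n² * ι (n ℕ.^ 2) ≡ 1ℚ
  1/n²-cancel = /-*-cancel 1 (n ℕ.^ 2)

  -- Both densities are expressed through the single quantity `1/n²`, which makes the final
  -- comparison a polynomial identity.
  ρ≡ : ρ G ≡ (|E| + |E|) * 1/n²
  ρ≡ = begin
    ρ G                            ≡⟨ ℚ.*-identityʳ (ρ G) ⟨
    ρ G * 1ℚ                       ≡⟨ cong (ρ G *_) 1/n²-cancel ⟨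
    ρ G * (1/n² * ι (n ℕ.^ 2))     ≡⟨ solve 3 (λ r i s → r :* (i :* s) := r :* s :* i) refl (ρ G) 1/n² (ι (n ℕ.^ 2)) ⟩
    ρ G * ι (n ℕ.^ 2) * 1/n²       ≡⟨ cong (_* 1/n²) (/-*-cancel (2 ℕ.* length (edges G)) (n ℕ.^ 2)) ⟩
    ι (2 ℕ.* length (edges G)) * 1/n² ≡⟨ cong (_* 1/n²) (ι-* 2 (length (edges G))) ⟩
    ι 2 * |E| * 1/n²               ≡⟨ cong (_* 1/n²) (solve 1 (λ e → con (ι 2) :* e := e :+ e) refl |E|) ⟩
    (|E| + |E|) * 1/n²             ∎
    where open ≡-Reasoning

  C₄≡ : C₄ G ≡ #C₄ * (1/n² * 1/n²)
  C₄≡ = begin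
    C₄ G                                     ≡⟨ ℚ.*-identityʳ (C₄ G) ⟨
    C₄ G * (1ℚ * 1ℚ)                         ≡⟨ cong (λ x → C₄ G * (x * x)) 1/n²-cancel ⟨
    C₄ G * (1/n² * s * (1/n² * s))
      ≡⟨ solve 3 (λ r i s → r :* (i :* s :* (i :* s)) := r :* (s :* s) :* (i :* i)) refl (C₄ G) 1/n² s ⟩
    C₄ G * (s * s) * (1/n² * 1/n²)
      ≡⟨ cong (λ x → C₄ G * x * (1/n² * 1/n²)) (trans (cong ι_ (ℕ.^-distribˡ-+-* n 2 2)) (ι-* (n ℕ.^ 2) (n ℕ.^ 2))) ⟨
    C₄ G * ι (n ℕ.^ 4) * (1/n² * 1/n²)
      ≡⟨ cong (_* (1/n² * 1/n²)) (/-*-cancel (length (filter C₄-sample? (allFin (n ℕ.^ 4)))) (n ℕ.^ 4)) ⟩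
    #C₄ * (1/n² * 1/n²)                      ∎
    where
    open ≡-Reasoning
    s = ι (n ℕ.^ 2)

  edgeSum : (Fin n → ℚ) → ℚ
  edgeSum μ = sumᴸ (λ (u , v) → μ u * μ v) (edges G)

  edgeSum-double : ∀ μ → edgeSum μ + edgeSum μ ≡ B μ μ
  edgeSum-double μ = sumᴸ-edges (λ u v → μ u * μ v) (λ u v → ℚ.*-comm (μ u) (μ v))

  seq-β : ∀ μ ν k → (∀ v → seq (μ v) k ≡ ν v) → seq (β G μ) k ≡ 1/n² * edgeSum ν
  seq-β μ ν k μ≡ν = cong (1/n² *_) (trans (seq-sumᴿ (λ (u , v) → μ u *ᴿ μ v) (edges G) k)
    (sumᴸ-cong {g = λ (u , v) → ν u * ν v} (λ (u , v) → cong₂ _*_ (μ≡ν u) (μ≡ν v)) (edges G)))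

  -- What the definition of a real half guarantees for its approximations at a single late index.
  AlmostIsHalf : ℚ → (Fin n → ℚ) → Set
  AlmostIsHalf η m = (∀ v → 0ℚ ≤ m v + η) × (∀ v → m v ≤ 1ℚ + η) × ∣ sum m - + n / 2 ∣ ≤ η

  isHalf⇒eventually : ∀ {μ η} → 0ℚ < η → IsHalf μ → ∃[ N ] ∀ k → N ℕ.≤ k → AlmostIsHalf η (λ v → seq (μ v) k)
  isHalf⇒eventually {μ} {η} 0<η (bounds , total) =
    combine-bounds (eventually-all (λ v → proj₁ (bounds v) η 0<η)) (eventually-all (λ v → proj₂ (bounds v) η 0<η))
      (total η 0<η)
    where
    combine-bounds :
      ∃[ N ] (∀ k → N ℕ.≤ k → ∀ v → 0ℚ ≤ seq (μ v) k + η) →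
      ∃[ N ] (∀ k → N ℕ.≤ k → ∀ v → seq (μ v) k ≤ 1ℚ + η) →
      ∃[ N ] (∀ k → N ℕ.≤ k → ∣ seq (sumᴿ (map μ (allFin n))) k - + n / 2 ∣ ≤ η) →
      ∃[ N ] ∀ k → N ℕ.≤ k → AlmostIsHalf η (λ v → seq (μ v) k)
    combine-bounds (L , low) (M , high) (N , close) = L ℕ.⊔ (M ℕ.⊔ N) , λ k le →
      let le′ = ℕ.m⊔n≤o⇒n≤o L (M ℕ.⊔ N) le in
      low k (ℕ.m⊔n≤o⇒m≤o L (M ℕ.⊔ N) le) , high k (ℕ.m⊔n≤o⇒m≤o M N le′) ,
      subst (λ x → ∣ x - + n / 2 ∣ ≤ η) (trans (seq-sumᴿ μ (allFin n) k) (sumᴸ-allFin (λ v → seq (μ v) k)))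
        (close k (ℕ.m⊔n≤o⇒n≤o M N le′))

  almostHalf-bound : ∀ {E* η m} → (∀ ν → IsHalfℚ ν → E* ≤ edgeSum ν) → 0ℚ ≤ η → ι 4 * η ≤ 1ℚ → AlmostIsHalf η m →
    E* ≤ edgeSum m + |E| * (ι 12 * η)
  almostHalf-bound {E*} {η} {m} minimal 0≤η 4η≤1 (low , high , close) =
    from-nearby (nearby-half {m = m} 0≤η 4η≤1 low high close)
    where
    from-nearby : ∃[ ν ] IsHalfℚ ν × (∀ u v → ν u * ν v ≤ m u * m v + ι 12 * η) → E* ≤ edgeSum m + |E| * (ι 12 * η)
    from-nearby (ν , half , ν*ν≤) = ℚ.≤-trans (minimal ν half) (subst (edgeSum ν ≤_)
      (sumᴸ-+-const (λ (u , v) → m u * m v) (ι 12 * η) (edges G))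
      (sumᴸ-mono {f = λ (u , v) → ν u * ν v} {g = λ (u , v) → m u * m v + ι 12 * η} (λ (u , v) → ν*ν≤ u v) (edges G)))

  -- At every late index the approximations of `μ` form an almost half. A rational half near it has
  -- edge sum at least that of `μ*`, and passing to it costs at most `12 η` per edge.
  β-lower-bound : ∀ {μ*} → (∀ ν → IsHalfℚ ν → edgeSum μ* ≤ edgeSum ν) →
    ∀ μ → IsHalf μ → β G (embed μ*) ≤ᴿ β G μ
  β-lower-bound {μ*} minimal μ half ε 0<ε = from-η (small-enough 0≤K 0<ε)
    where
    -- The total error per unit of `η`, after scaling by `1/n²`.
    K = 1/n² * (|E| * ι 12)
    0≤K : 0ℚ ≤ K
    0≤K = 0≤* 0≤1/n² (0≤* (0≤ι (length (edges G))) (0≤ι 12))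
    from-η : ∃[ η ] 0ℚ < η × ι 4 * η ≤ 1ℚ × K * η ≤ ε →
      ∃[ N ] ∀ k → N ℕ.≤ k → seq (β G (embed μ*)) k ≤ seq (β G μ) k + ε
    from-η (η , 0<η , 4η≤1 , Kη≤ε) = proj₁ almost , λ k N≤k →
      subst₂ (λ x y → x ≤ y + ε) (sym (seq-β (embed μ*) μ* k λ _ → refl)) (sym (seq-β μ (λ v → seq (μ v) k) k λ _ → refl)) (at k N≤k)
      where
      almost = isHalf⇒eventually {μ} 0<η half
      at : ∀ k → proj₁ almost ℕ.≤ k → 1/n² * edgeSum μ* ≤ 1/n² * edgeSum (λ v → seq (μ v) k) + ε
      at k N≤k = scale-error {1/n²} {ι 12} {|E|} {η} {ε} {edgeSum μ*} {edgeSum (λ v → seq (μ v) k)} 0≤1/n² Kη≤ε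
        (almostHalf-bound {edgeSum μ*} {η} {λ v → seq (μ v) k} minimal (ℚ.<⇒≤ 0<η) 4η≤1 (proj₂ almost k N≤k))

  fromℚ-isHalf : ∀ {μ} → IsHalfℚ μ → IsHalf (embed μ)
  fromℚ-isHalf {μ} (bounds , total) =
    (λ v → fromℚ-mono (proj₁ (bounds v)) , fromℚ-mono (proj₂ (bounds v))) ,
    ≈ᴿ-reflexive (sumᴿ (map (embed μ) (allFin n))) (fromℚ (+ n / 2))
      (λ k → trans (seq-sumᴿ (embed μ) (allFin n) k) (trans (sumᴸ-allFin μ) total))

  -- Multiplication by the positive `12ρ G` removes the quotient. What remains is a nonnegative
  -- combination of the averaged bound over edges and `count≤3hom`.
  density-bound : TriangleFree G → (e : HasEdge G) → ∀ {μ*} → (∀ ν → IsHalfℚ ν → B μ* μ* ≤ B ν ν) →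
    1/n² * edgeSum μ* ≤ (+ 1 / 8) * ρ G - _÷_ (C₄ G) (12ρ G) {{12ρ-nonZero G e}}
  density-bound triangleFree e {μ*} minimal = *-cancelʳ-≤ {i * E} {(+ 1 / 8) * ρ G - X} 0<12ρ (≤-by-difference difference
    (0≤* (0≤* 0≤1/n² 0≤1/n²) (0≤+ (0≤* (ℚ.nonNegative⁻¹ (+ 3 / 2)) (p≤q⇒0≤q-p bound)) (p≤q⇒0≤q-p count≤3hom))))
    where
    instance
      12ρ≢0 = 12ρ-nonZero G e
    i = 1/n²
    E = edgeSum μ*
    X = C₄ G ÷ 12ρ G
    0≤12ρ : 0ℚ ≤ 12ρ G
    0≤12ρ = 0≤* (0≤ι 12) (ℚ.nonNegative⁻¹ (ρ G) {{ℚ.normalize-nonNeg (2 ℕ.* length (edges G)) (n ℕ.^ 2)}})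
    0<12ρ : 0ℚ < 12ρ G
    0<12ρ = ℚ.positive⁻¹ (12ρ G) {{ℚ.nonNeg∧nonZero⇒pos (12ρ G) {{nonNegative 0≤12ρ}}}}
    B𝟏𝟏 : B (λ _ → 1ℚ) (λ _ → 1ℚ) ≡ |E| + |E|
    B𝟏𝟏 = trans (sym (edgeSum-double (λ _ → 1ℚ))) (cong (λ x → x + x) (sumᴸ-one (edges G)))
    bound : ι 4 * (E + E) * (|E| + |E|) + (hom + hom) ≤ (|E| + |E|) * (|E| + |E|)
    bound = subst₂ _≤_
      (trans (cong₂ (λ x y → ι 4 * B μ* μ* * x + (y + y)) B𝟏𝟏 nbhd-sum≡hom)
        (cong (λ x → ι 4 * x * (|E| + |E|) + (hom + hom)) (sym (edgeSum-double μ*))))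
      (cong (λ x → x * x) B𝟏𝟏)
      (EdgeHalves.minimizer-bound G triangleFree {μ*} minimal)
    -- The weight `3 / 2` turns `hom + hom` into `ι 3 * hom`, which cancels against the second
    -- summand.
    difference : ((+ 1 / 8) * ρ G - X) * 12ρ G - i * E * 12ρ G ≡
      i * i * ((+ 3 / 2) * ((|E| + |E|) * (|E| + |E|) - (ι 4 * (E + E) * (|E| + |E|) + (hom + hom))) + (ι 3 * hom - #C₄))
    difference = begin
      ((+ 1 / 8) * ρ G - X) * 12ρ G - i * E * 12ρ G
        ≡⟨ solve 4 (λ r x t y → (con (+ 1 / 8) :* r :- x) :* t :- y :* t := con (+ 1 / 8) :* r :* t :- x :* t :- y :* t)
             refl (ρ G) X (12ρ G) (i * E) ⟩
      (+ 1 / 8) * ρ G * 12ρ G - X * 12ρ G - i * E * 12ρ G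
        ≡⟨ cong (λ x → (+ 1 / 8) * ρ G * 12ρ G - x - i * E * 12ρ G) (trans (÷-*-cancel (C₄ G) (12ρ G)) C₄≡) ⟩
      (+ 1 / 8) * ρ G * (ι 12 * ρ G) - #C₄ * (i * i) - i * E * (ι 12 * ρ G)
        ≡⟨ cong (λ r → (+ 1 / 8) * r * (ι 12 * r) - #C₄ * (i * i) - i * E * (ι 12 * r)) ρ≡ ⟩
      (+ 1 / 8) * ((|E| + |E|) * i) * (ι 12 * ((|E| + |E|) * i)) - #C₄ * (i * i) - i * E * (ι 12 * ((|E| + |E|) * i))
        ≡⟨ solve 5 (λ i E m c h →
             con (+ 1 / 8) :* ((m :+ m) :* i) :* (con (ι 12) :* ((m :+ m) :* i)) :- c :* (i :* i)
               :- i :* E :* (con (ι 12) :* ((m :+ m) :* i)) :=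
             i :* i :* (con (+ 3 / 2) :* ((m :+ m) :* (m :+ m) :- (con (ι 4) :* (E :+ E) :* (m :+ m) :+ (h :+ h)))
               :+ (con (ι 3) :* h :- c))) refl i E |E| #C₄ hom ⟩
      i * i * ((+ 3 / 2) * ((|E| + |E|) * (|E| + |E|) - (ι 4 * (E + E) * (|E| + |E|) + (hom + hom))) + (ι 3 * hom - #C₄)) ∎
      where open ≡-Reasoning

  minimizer⇒minβ : ∀ {μ*} → IsHalfℚ μ* → (∀ ν → IsHalfℚ ν → B μ* μ* ≤ B ν ν) → IsMinβ G (β G (embed μ*))
  minimizer⇒minβ {μ*} half* minimal =
    (embed μ* , fromℚ-isHalf half* , ≈ᴿ-reflexive (β G (embed μ*)) (β G (embed μ*)) (λ _ → refl)) ,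
    β-lower-bound {μ*} λ ν half → double-cancel-≤
      (subst₂ _≤_ (sym (edgeSum-double μ*)) (sym (edgeSum-double ν)) (minimal ν half))

  β-upper-bound : TriangleFree G → (e : HasEdge G) → ∀ {μ*} → (∀ ν → IsHalfℚ ν → B μ* μ* ≤ B ν ν) →
    β G (embed μ*) ≤ᴿ fromℚ ((+ 1 / 8) * ρ G - _÷_ (C₄ G) (12ρ G) {{12ρ-nonZero G e}})
  β-upper-bound triangleFree e {μ*} minimal = ≤⇒≤ᴿ {β G (embed μ*)} (1/n² * edgeSum μ*)
    (λ k → seq-β (embed μ*) μ* k λ _ → refl) (density-bound triangleFree e {μ*} minimal)

proposition1p1 : ∀ (n : ℕ) .{{_ : NonZero n}} (G : Graph n) →
    TriangleFree G → (e : HasEdge G) →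
    ∃[ b ] IsMinβ G b ×
    b ≤ᴿ fromℚ ((+ 1 / 8) * ρ G - _÷_ (C₄ G) (12ρ G) {{12ρ-nonZero G e}})
-- An end of the given edge serves as the initial exceptional index of the rounding.
proposition1p1 n G triangleFree e = conclude (Minimum.minimizer G (proj₁ e))
  where
  open BilinearForm G
  open Density G
  conclude : ∃[ μ* ] IsHalfℚ μ* × (∀ ν → IsHalfℚ ν → B μ* μ* ≤ B ν ν) →
    ∃[ b ] IsMinβ G b × b ≤ᴿ fromℚ ((+ 1 / 8) * ρ G - _÷_ (C₄ G) (12ρ G) {{12ρ-nonZero G e}})
  conclude (μ* , half* , minimal) = β G (embed μ*) , minimizer⇒minβ {μ*} half* minimal , β-upper-bound triangleFree e {μ*} minimal
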